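{- There exists an absolute constant $C>0$ such that the following holds. Let $n\ge 2$ and let $G=(A\cup B,E)$ be a bipartite graph with $|A|=|B|=n$ and average degree $d>0$. If $G$ is an $\alpha$-multitasker, where $\alpha\in(0,1]$, then $\alpha\le C\left(\frac{\log n}{d}\right)^{1/3}$.
   Context: Graphs are finite and simple. A matching is a set of edges no two of which share a vertex. A matching $M'$ in $G$ is induced if no two distinct edges of $M'$ are joined by an edge of $G$. A bipartite graph $G=(A\cup B,E)$ with $|A|=|B|=n$ is an $\alpha$-multitasker if every matching $M$ in $G$ (of any size $k=1,\dots,n$) contains a matching $M'\subseteq M$ that is induced in $G$ with $|M'|\ge\alpha|M|$. -}

module Defs where

open import Data.Bool using (Bool; T)
open import Data.Fin using (Fin)
open import Data.Integer as ℤ using (+_)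
import Data.Integer.Properties as ℤ
open import Data.List using (List; length; map; sum; allFin; filterᵇ)
open import Data.List.Membership.Propositional using (_∈_)
open import Data.List.Relation.Binary.Subset.Propositional using (_⊆_)
open import Data.List.Relation.Unary.All using (All)
open import Data.List.Relation.Unary.AllPairs using (AllPairs)
open import Data.Nat as ℕ using (ℕ; zero; suc)
import Data.Nat.Properties as ℕ
open import Data.Nat.Solver using () renaming (module +-*-Solver to ℕ-Solver)
open import Data.Product using (∃; ∃₂; _×_; _,_; proj₁; proj₂)
open import Data.Rational
open import Data.Rational.Properties
open import Data.Rational.Solver using () renaming (module +-*-Solver to ℚ-Solver)
import Data.Rational.Unnormalised as ℚᵘ
import Data.Rational.Unnormalised.Properties as ℚᵘ
open import Data.Sum using (_⊎_; inj₁; inj₂)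
open import Relation.Binary.PropositionalEquality
open import Relation.Nullary using (¬_; yes; no; contradiction)

------------------------------------------------------------------------
-- Nonnegative real numbers

-- A nonnegative real x is represented by the left half of its Dedekind
-- cut, restricted to positive rationals: Below q means 0 < q < x.
-- The number 0 is the empty cut.
record ℝ≥0 : Set₁ where
  field
    Below      : ℚ → Set
    isPositive : ∀ {q} → Below q → 0ℚ < q
    downward   : ∀ {p q} → 0ℚ < p → p < q → Below q → Below p
    open-above : ∀ {q} → Below q → ∃ λ r → q < r × Below r
    bounded    : ∃ λ u → ∀ {q} → Below q → q ≤ u

open ℝ≥0 public

infix  4 _≤ᴿ_
infixl 7 _*ᴿ_ _÷ᴿ_
infix  8 ∛_
infix  4 0<ᴿ_

_≤ᴿ_ : ℝ≥0 → ℝ≥0 → Set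
x ≤ᴿ y = ∀ {q} → Below x q → Below y q

0<ᴿ_ : ℝ≥0 → Set
0<ᴿ x = ∃ λ q → Below x q

-- Negative rationals are sent to 0.
fromℚ : ℚ → ℝ≥0
fromℚ r = record
  { Below      = λ q → 0ℚ < q × q < r
  ; isPositive = proj₁
  ; downward   = λ 0<p p<q (_ , q<r) → 0<p , <-trans p<q q<r
  ; open-above = λ (0<q , q<r) →
      let (s , q<s , s<r) = <-dense q<r
      in s , q<s , <-trans 0<q q<s , s<r
  ; bounded    = r , λ (_ , q<r) → <⇒≤ q<r
  }

fromℕ : ℕ → ℝ≥0
fromℕ k = fromℚ (+ k / 1)

*-mono-≤⁺ : ∀ {a b c d} → 0ℚ < a → 0ℚ < d → a ≤ b → c ≤ d → a * c ≤ b * d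
*-mono-≤⁺ {a} {b} {c} {d} 0<a 0<d a≤b c≤d = ≤-trans
  (*-monoˡ-≤-nonNeg a {{nonNegative (<⇒≤ 0<a)}} c≤d)
  (*-monoʳ-≤-nonNeg d {{nonNegative (<⇒≤ 0<d)}} a≤b)

*-pos : ∀ {a b} → 0ℚ < a → 0ℚ < b → 0ℚ < a * b
*-pos {a} {b} 0<a 0<b =
  positive⁻¹ (a * b) {{pos*pos⇒pos a {{positive 0<a}} b {{positive 0<b}}}}

_*ᴿ_ : ℝ≥0 → ℝ≥0 → ℝ≥0
x *ᴿ y = record
  { Below      = λ q → 0ℚ < q × ∃₂ λ a b → Below x a × Below y b × q ≤ a * b
  ; isPositive = proj₁
  ; downward   = λ 0<p p<q (_ , a , b , xa , yb , q≤ab) →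
      0<p , a , b , xa , yb , ≤-trans (<⇒≤ p<q) q≤ab
  ; open-above = λ (0<q , a , b , xa , yb , q≤ab) →
      let (a′ , a<a′ , xa′) = open-above x xa
          q<a′b = ≤-<-trans q≤ab
                    (*-monoˡ-<-pos b {{positive (isPositive y yb)}} a<a′)
      in a′ * b , q<a′b , <-trans 0<q q<a′b , a′ , b , xa′ , yb , ≤-refl
  ; bounded    = proj₁ (bounded x) * proj₁ (bounded y) ,
      λ (_ , a , b , xa , yb , q≤ab) → ≤-trans q≤ab
        (*-mono-≤⁺ (isPositive x xa)
                   (<-≤-trans (isPositive y yb) (proj₂ (bounded y) yb))
                   (proj₂ (bounded x) xa) (proj₂ (bounded y) yb))
  }

_÷ᴿ_ : ℝ≥0 → (r : ℚ) .{{_ : Positive r}} → ℝ≥0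
x ÷ᴿ r = record
  { Below      = λ q → Below x (q * r)
  ; isPositive = λ {q} xqr → *-cancelʳ-<-nonNeg r
      (subst (_< q * r) (sym (*-zeroˡ r)) (isPositive x xqr))
  ; downward   = λ {p} 0<p p<q → downward x
      (subst (_< p * r) (*-zeroˡ r) (*-monoˡ-<-pos r 0<p)) (*-monoˡ-<-pos r p<q)
  ; open-above = λ {q} xqr →
      let (s , qr<s , xs) = open-above x xqr
      in s * 1/ r , *-cancelʳ-<-nonNeg r (subst (q * r <_) (sym (undo s)) qr<s)
                  , subst (Below x) (sym (undo s)) xs
  ; bounded    = proj₁ (bounded x) * 1/ r , λ {q} xqr → *-cancelʳ-≤-pos r
      (subst (q * r ≤_) (sym (undo _)) (proj₂ (bounded x) xqr))
  }
  where
  instance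
    _ : NonNegative r
    _ = pos⇒nonNeg r
    _ : NonZero r
    _ = pos⇒nonZero r
  undo : ∀ s → s * 1/ r * r ≡ s
  undo s = trans (*-assoc s (1/ r) r)
                 (trans (cong (s *_) (*-inverseˡ r)) (*-identityʳ s))

cube : ℚ → ℚ
cube q = q * q * q

cube-pos : ∀ {q} → 0ℚ < q → 0ℚ < cube q
cube-pos 0<q = *-pos (*-pos 0<q 0<q) 0<q

cube-mono-< : ∀ {p q} → 0ℚ < p → p < q → cube p < cube q
cube-mono-< {p} {q} 0<p p<q = ≤-<-trans
  (*-monoʳ-≤-nonNeg p {{nonNegative (<⇒≤ 0<p)}}
    (*-mono-≤⁺ 0<p 0<q (<⇒≤ p<q) (<⇒≤ p<q)))
  (*-monoʳ-<-pos (q * q) {{positive (*-pos 0<q 0<q)}} p<q)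
  where 0<q = <-trans 0<p p<q

cube-bound : ∀ {q u} → cube q ≤ u → q ≤ 1ℚ ⊔ u
cube-bound {q} {u} q³≤u with q ≤? 1ℚ
... | yes q≤1 = ≤-trans q≤1 (p≤p⊔q 1ℚ u)
... | no  q≰1 = ≤-trans q≤q³ (≤-trans q³≤u (p≤q⊔p 1ℚ u))
  where
  1≤q = <⇒≤ (≰⇒> q≰1)
  0<q = <-≤-trans (positive⁻¹ 1ℚ) 1≤q
  q≤q³ : q ≤ cube q
  q≤q³ = subst (_≤ cube q) (*-identityˡ q)
    (*-monoʳ-≤-nonNeg q {{nonNegative (<⇒≤ 0<q)}}
      (*-mono-≤⁺ (positive⁻¹ 1ℚ) 0<q 1≤q 1≤q))

3ℚ : ℚ
3ℚ = + 3 / 1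

cube-continuous : ∀ {q s} → 0ℚ < q → cube q < s → ∃ λ r → q < r × cube r ≤ s
cube-continuous {q} {s} 0<q q³<s = q + δ , q<q+δ , bound
  where
  e K : ℚ
  e = s - cube q
  K = 3ℚ * (q * q) + 3ℚ * q * 1ℚ + 1ℚ * 1ℚ
  0<3q : 0ℚ < 3ℚ * q
  0<3q = *-pos (positive⁻¹ 3ℚ) 0<q
  0<e : 0ℚ < e
  0<e = subst (_< e) (+-inverseʳ (cube q)) (+-monoˡ-< (- cube q) q³<s)
  0<K : 0ℚ < K
  0<K = +-mono-< (+-mono-< (*-pos (positive⁻¹ 3ℚ) (*-pos 0<q 0<q))
                           (*-pos 0<3q (positive⁻¹ 1ℚ)))
                 (positive⁻¹ 1ℚ)
  instance
    K-pos : Positive K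
    K-pos = positive 0<K
    K-nz : NonZero K
    K-nz = pos⇒nonZero K
  δ : ℚ
  δ = 1ℚ ⊓ (e * 1/ K)
  0<δ : 0ℚ < δ
  0<δ with ⊓-sel 1ℚ (e * 1/ K)
  ... | inj₁ eq = subst (0ℚ <_) (sym eq) (positive⁻¹ 1ℚ)
  ... | inj₂ eq = subst (0ℚ <_) (sym eq)
                    (*-pos 0<e (positive⁻¹ (1/ K) {{1/pos⇒pos K}}))
  δ≤1 : δ ≤ 1ℚ
  δ≤1 = p⊓q≤p 1ℚ (e * 1/ K)
  δK≤e : δ * K ≤ e
  δK≤e = subst (δ * K ≤_)
    (trans (*-assoc e (1/ K) K)
           (trans (cong (e *_) (*-inverseˡ K)) (*-identityʳ e)))
    (*-monoʳ-≤-nonNeg K {{nonNegative (<⇒≤ 0<K)}} (p⊓q≤q 1ℚ (e * 1/ K)))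
  q<q+δ : q < q + δ
  q<q+δ = subst (_< q + δ) (+-identityʳ q) (+-monoʳ-< q 0<δ)
  expand : cube (q + δ) ≡
           cube q + δ * (3ℚ * (q * q) + 3ℚ * q * δ + δ * δ)
  expand = solve 2 (λ x d →
      (x :+ d) :* (x :+ d) :* (x :+ d) :=
      x :* x :* x :+
        d :* (con 3ℚ :* (x :* x) :+ con 3ℚ :* x :* d :+ d :* d))
    refl q δ
    where open ℚ-Solver
  back : cube q + e ≡ s
  back = solve 2 (λ c t → c :+ (t :+ :- c) := t) refl (cube q) s
    where open ℚ-Solver
  bound : cube (q + δ) ≤ s
  bound = subst₂ _≤_ (sym expand) back (+-monoʳ-≤ (cube q)
    (≤-trans
      (*-monoˡ-≤-nonNeg δ {{nonNegative (<⇒≤ 0<δ)}}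
        (+-mono-≤
          (+-monoʳ-≤ (3ℚ * (q * q))
            (*-monoˡ-≤-nonNeg (3ℚ * q) {{nonNegative (<⇒≤ 0<3q)}} δ≤1))
          (*-mono-≤⁺ 0<δ (positive⁻¹ 1ℚ) δ≤1 δ≤1)))
      δK≤e))

∛_ : ℝ≥0 → ℝ≥0
∛ x = record
  { Below      = λ q → 0ℚ < q × Below x (cube q)
  ; isPositive = proj₁
  ; downward   = λ 0<p p<q (_ , xq³) →
      0<p , downward x (cube-pos 0<p) (cube-mono-< 0<p p<q) xq³
  ; open-above = λ (0<q , xq³) →
      let (s , q³<s , xs)   = open-above x xq³
          (t , q³<t , t<s)  = <-dense q³<s
          (r , q<r , r³≤t)  = cube-continuous 0<q q³<t
          0<r               = <-trans 0<q q<r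
      in r , q<r , 0<r , downward x (cube-pos 0<r) (≤-<-trans r³≤t t<s) xs
  ; bounded    = 1ℚ ⊔ proj₁ (bounded x) ,
      λ (_ , xq³) → cube-bound (proj₂ (bounded x) xq³)
  }

/-mono-≤ : ∀ a b c d → a ℕ.* suc d ℕ.≤ c ℕ.* suc b → + a / suc b ≤ + c / suc d
/-mono-≤ a b c d ad≤cb = toℚᵘ-cancel-≤ (begin
  toℚᵘ (+ a / suc b)  ≃⟨ toℚᵘ-fromℚᵘ (ℚᵘ.mkℚᵘ (+ a) b) ⟩
  ℚᵘ.mkℚᵘ (+ a) b     ≤⟨ ℚᵘ.*≤* (subst₂ ℤ._≤_ (ℤ.pos-* a (suc d)) (ℤ.pos-* c (suc b))
                                   (ℤ.+≤+ ad≤cb)) ⟩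
  ℚᵘ.mkℚᵘ (+ c) d     ≃⟨ toℚᵘ-fromℚᵘ (ℚᵘ.mkℚᵘ (+ c) d) ⟨
  toℚᵘ (+ c / suc d)  ∎)
  where open ℚᵘ.≤-Reasoning

/-mono-< : ∀ a b c d → a ℕ.* suc d ℕ.< c ℕ.* suc b → + a / suc b < + c / suc d
/-mono-< a b c d ad<cb = toℚᵘ-cancel-< (begin-strict
  toℚᵘ (+ a / suc b)  ≃⟨ toℚᵘ-fromℚᵘ (ℚᵘ.mkℚᵘ (+ a) b) ⟩
  ℚᵘ.mkℚᵘ (+ a) b     <⟨ ℚᵘ.*<* (subst₂ ℤ._<_ (ℤ.pos-* a (suc d)) (ℤ.pos-* c (suc b))
                                   (ℤ.+<+ ad<cb)) ⟩
  ℚᵘ.mkℚᵘ (+ c) d     ≃⟨ toℚᵘ-fromℚᵘ (ℚᵘ.mkℚᵘ (+ c) d) ⟨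
  toℚᵘ (+ c / suc d)  ∎)
  where open ℚᵘ.≤-Reasoning

bernoulli : ∀ x k → (x ℕ.+ k) ℕ.* x ℕ.^ k ℕ.≤ x ℕ.* suc x ℕ.^ k
bernoulli x zero    = ℕ.≤-reflexive (cong (ℕ._* 1) (ℕ.+-identityʳ x))
bernoulli x (suc k) = begin
  (x ℕ.+ suc k) ℕ.* (x ℕ.* p)            ≤⟨ ℕ.m≤m+n _ (k ℕ.* p) ⟩
  (x ℕ.+ suc k) ℕ.* (x ℕ.* p) ℕ.+ k ℕ.* p  ≡⟨ lemma₁ ⟩
  suc x ℕ.* ((x ℕ.+ k) ℕ.* p)            ≤⟨ ℕ.*-monoʳ-≤ (suc x) (bernoulli x k) ⟩
  suc x ℕ.* (x ℕ.* suc x ℕ.^ k)          ≡⟨ lemma₂ ⟩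
  x ℕ.* (suc x ℕ.* suc x ℕ.^ k)          ∎
  where
  open ℕ.≤-Reasoning
  open ℕ-Solver
  p = x ℕ.^ k
  lemma₁ : (x ℕ.+ suc k) ℕ.* (x ℕ.* p) ℕ.+ k ℕ.* p ≡ suc x ℕ.* ((x ℕ.+ k) ℕ.* p)
  lemma₁ = solve 3 (λ x k p →
      (x :+ (con 1 :+ k)) :* (x :* p) :+ k :* p := (con 1 :+ x) :* ((x :+ k) :* p))
    refl x k p
  lemma₂ : suc x ℕ.* (x ℕ.* suc x ℕ.^ k) ≡ x ℕ.* (suc x ℕ.* suc x ℕ.^ k)
  lemma₂ = solve 2 (λ x p → (con 1 :+ x) :* (x :* p) := x :* ((con 1 :+ x) :* p))
    refl x (suc x ℕ.^ k)

power-gap : ∀ x .{{_ : ℕ.NonZero x}} → 2 ℕ.* x ℕ.^ suc x ℕ.< suc x ℕ.^ suc x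
power-gap x = ℕ.*-cancelˡ-< x _ _ (begin-strict
  x ℕ.* (2 ℕ.* p)      <⟨ ℕ.m<m+n _ (ℕ.m^n>0 x (suc x)) ⟩
  x ℕ.* (2 ℕ.* p) ℕ.+ p  ≡⟨ solve 2 (λ x p → x :* (con 2 :* p) :+ p :=
                                     (x :+ (con 1 :+ x)) :* p) refl x p ⟩
  (x ℕ.+ suc x) ℕ.* p  ≤⟨ bernoulli x (suc x) ⟩
  x ℕ.* suc x ℕ.^ suc x ∎)
  where
  open ℕ.≤-Reasoning
  open ℕ-Solver
  p = x ℕ.^ suc x

n<2^n : ∀ n → n ℕ.< 2 ℕ.^ n
n<2^n zero    = ℕ.s≤s ℕ.z≤n
n<2^n (suc n) = begin-strict
  suc n                    ≤⟨ n<2^n n ⟩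
  2 ℕ.^ n                  <⟨ ℕ.^-monoʳ-< 2 ℕ.≤-refl (ℕ.n<1+n n) ⟩
  2 ℕ.^ suc n              ∎
  where open ℕ.≤-Reasoning

-- The logarithm to base 2, as the supremum of all fractions a / (1 + b)
-- with 2 ^ a < n ^ (1 + b); by convention log₂ 0 = 0.
log₂ : ℕ → ℝ≥0
log₂ n = record
  { Below      = λ q → 0ℚ < q ×
                   ∃₂ λ a b → q ≤ + a / suc b × 2 ℕ.^ a ℕ.< n ℕ.^ suc b
  ; isPositive = proj₁
  ; downward   = λ 0<p p<q (_ , a , b , q≤a/b , lt) →
      0<p , a , b , ≤-trans (<⇒≤ p<q) q≤a/b , lt
  ; open-above = λ (0<q , a , b , q≤a/b , lt) →
      let k    = 2 ℕ.^ a
          a′   = suc (a ℕ.* suc k)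
          b′   = b ℕ.+ k ℕ.* suc b
          q<r  = ≤-<-trans q≤a/b (/-mono-< a b a′ b′ (step a b k))
      in + a′ / suc b′ , q<r , <-trans 0<q q<r , a′ , b′ , ≤-refl , gap a b lt
  ; bounded    = + n / 1 , λ (_ , a , b , q≤a/b , lt) →
      ≤-trans q≤a/b (/-mono-≤ a b n 0
        (subst (ℕ._≤ n ℕ.* suc b) (sym (ℕ.*-identityʳ a)) (upper a b lt)))
  }
  where
  open ℕ.≤-Reasoning
  step : ∀ a b k → a ℕ.* suc (b ℕ.+ k ℕ.* suc b) ℕ.< suc (a ℕ.* suc k) ℕ.* suc b
  step a b k = begin-strict
    a ℕ.* (suc k ℕ.* suc b)            ≡⟨ ℕ.*-assoc a (suc k) (suc b) ⟨
    a ℕ.* suc k ℕ.* suc b              <⟨ ℕ.m<n+m _ (ℕ.s≤s ℕ.z≤n) ⟩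
    suc b ℕ.+ a ℕ.* suc k ℕ.* suc b    ∎
  gap : ∀ a b → 2 ℕ.^ a ℕ.< n ℕ.^ suc b →
        2 ℕ.^ suc (a ℕ.* suc (2 ℕ.^ a)) ℕ.< n ℕ.^ suc (b ℕ.+ 2 ℕ.^ a ℕ.* suc b)
  gap a b lt = begin-strict
    2 ℕ.* 2 ℕ.^ (a ℕ.* suc k)    ≡⟨ cong (2 ℕ.*_) (ℕ.^-*-assoc 2 a (suc k)) ⟨
    2 ℕ.* k ℕ.^ suc k            <⟨ power-gap k {{ℕ.m^n≢0 2 a}} ⟩
    suc k ℕ.^ suc k              ≤⟨ ℕ.^-monoˡ-≤ (suc k) lt ⟩
    (n ℕ.^ suc b) ℕ.^ suc k      ≡⟨ ℕ.^-*-assoc n (suc b) (suc k) ⟩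
    n ℕ.^ (suc b ℕ.* suc k)      ≡⟨ cong (n ℕ.^_) (ℕ.*-comm (suc b) (suc k)) ⟩
    n ℕ.^ (suc k ℕ.* suc b)      ∎
    where k = 2 ℕ.^ a
  upper : ∀ a b → 2 ℕ.^ a ℕ.< n ℕ.^ suc b → a ℕ.≤ n ℕ.* suc b
  upper a b lt with a ℕ.≤? n ℕ.* suc b
  ... | yes a≤nb = a≤nb
  ... | no  a≰nb = contradiction (begin-strict
    2 ℕ.^ a                <⟨ lt ⟩
    n ℕ.^ suc b            ≤⟨ ℕ.^-monoˡ-≤ (suc b) (ℕ.<⇒≤ (n<2^n n)) ⟩
    (2 ℕ.^ n) ℕ.^ suc b    ≡⟨ ℕ.^-*-assoc 2 n (suc b) ⟩
    2 ℕ.^ (n ℕ.* suc b)    ≤⟨ ℕ.^-monoʳ-≤ 2 (ℕ.<⇒≤ (ℕ.≰⇒> a≰nb)) ⟩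
    2 ℕ.^ a                ∎) (ℕ.<-irrefl refl)

------------------------------------------------------------------------
-- Bipartite graphs and matchings

-- Both parts A and B are copies of Fin n.  Adjacency is only recorded from
-- A to B, so the graph is simple and has no edge inside A or inside B.
BipartiteGraph : ℕ → Set
BipartiteGraph n = Fin n → Fin n → Bool

module _ {n : ℕ} (G : BipartiteGraph n) where

  degreeA degreeB : Fin n → ℕ
  degreeA a = length (filterᵇ (λ b → G a b) (allFin n))
  degreeB b = length (filterᵇ (λ a → G a b) (allFin n))

  averageDegree : .{{_ : ℕ.NonZero n}} → ℚ
  averageDegree =
    (+ (sum (map degreeA (allFin n)) ℕ.+ sum (map degreeB (allFin n))) / (2 ℕ.* n))
      {{ℕ.m*n≢0 2 n}}

  IsEdge : Fin n × Fin n → Set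
  IsEdge (a , b) = T (G a b)

  NoSharedVertex : Fin n × Fin n → Fin n × Fin n → Set
  NoSharedVertex (a , b) (a′ , b′) = a ≢ a′ × b ≢ b′

  -- AllPairs NoSharedVertex rules out repetitions, so length is the number
  -- of edges of the matching.
  IsMatching : List (Fin n × Fin n) → Set
  IsMatching M = All IsEdge M × AllPairs NoSharedVertex M

  Joined : Fin n × Fin n → Fin n × Fin n → Set
  Joined (a , b) (a′ , b′) = IsEdge (a , b′) ⊎ IsEdge (a′ , b)

  IsInduced : List (Fin n × Fin n) → Set
  IsInduced M = ∀ {e e′} → e ∈ M → e′ ∈ M → e ≢ e′ → ¬ Joined e e′

IsMultitasker : ∀ {n} → ℝ≥0 → BipartiteGraph n → Set
IsMultitasker α G = ∀ M → IsMatching G M →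
  ∃ λ M′ → IsMatching G M′ × M′ ⊆ M × IsInduced G M′ ×
           α *ᴿ fromℕ (length M) ≤ᴿ fromℕ (length M′)

{- Let h ~ 1/α and c ~ h².  In a graph R with all degrees at most c, at most m vertices
   on either side and at least cm/2 edges, choose s ~ m/8 matching edges one after the
   other at random.  Give each M′ ⊆ M that is induced with respect to the order of choice
   the weight 5^|M′| (1 + 1/y)^r, where y ~ h and r is the number of vertices of B outside
   N(M′).  Since x (1 + 1/y)^(-x) ≤ y, a random next edge multiplies the total weight by at
   most 1 + O(1/h) on average, so the expectation can be followed by a greedy choice.  The
   resulting matching has total weight at most 4^(s/h), while an induced submatching of
   size k ≥ s/h alone would contribute 5^k.

   A graph of average degree d contains, after deleting vertices of low degree, a pair
   (X, Y) with |Y| ≤ |X| in which every vertex of X has degree of order d.  Take a maximal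
   subgraph R of maximum degree c.  Either R is as above, or fewer than half of the
   vertices are saturated, and then the unsaturated vertices of X send all but c of their
   edges to the saturated part of Y.  Each iteration halves Y, so d = O(c log n), and
   c log n ~ h² log n ≤ h³ log n. -}
module Submission where

open import Data.Bool using (Bool; true; false; T; not; _∧_; _∨_)
open import Data.Bool.Properties using (∧-comm)
open import Data.Empty using (⊥; ⊥-elim)
open import Data.Fin using (Fin)
import Data.Fin.Properties as Fin
import Data.Integer as ℤ
import Data.Integer.Properties as ℤ
open import Data.List using (List; []; _∷_; length; map; filter; filterᵇ; take; allFin; cartesianProduct)
import Data.List.Membership.DecPropositional as DecMembership
open import Data.List.Membership.Propositional using (_∈_)
open import Data.List.Membership.Propositional.Properties
  using (∈-filter⁻; ∈-cartesianProduct⁺; ∈-map⁻)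
open import Data.List.Properties
  using (length-map; length-take; length-filter; length-tabulate; filter-notAll)
open import Data.List.Relation.Binary.Subset.Propositional using (_⊆_)
open import Data.List.Relation.Unary.All as All using (All; []; _∷_)
import Data.List.Relation.Unary.All.Properties as All
open import Data.List.Relation.Unary.AllPairs as AllPairs using (AllPairs; []; _∷_)
import Data.List.Relation.Unary.AllPairs.Properties as AllPairs
open import Data.List.Relation.Unary.Any using (here; there)
open import Data.List.Relation.Unary.Unique.Propositional using (Unique)
import Data.List.Relation.Unary.Unique.Propositional.Properties as Unique
open import Data.Nat using (ℕ; zero; suc; pred; _+_; _*_; _^_; _≤_; _<_; z≤n; s≤s; _≤?_; _<?_; NonZero; _/_; _%_;
  >-nonZero; >-nonZero⁻¹; ≢-nonZero)
open import Data.Nat.DivMod using (m≡m%n+[m/n]*n; m%n<n; m≥n⇒m/n>0; m/n*n≤m)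
open import Data.Nat.ListAction using (sum)
open import Data.Nat.Properties
open import Data.Nat.Solver using (module +-*-Solver)
open import Data.Product using (∃; ∃₂; _×_; _,_; proj₁; proj₂; swap)
open import Data.Product.Properties using (≡-dec)
import Data.Rational as ℚ
open import Data.Rational using (ℚ; 0ℚ; 1ℚ; Positive)
import Data.Rational.Properties as ℚ
open import Data.Rational.Solver using () renaming (module +-*-Solver to ℚ-Solver)
import Data.Rational.Unnormalised as ℚᵘ
import Data.Rational.Unnormalised.Properties as ℚᵘ
open import Data.Sum as Sum using (_⊎_; inj₁; inj₂)
open import Data.Unit using (tt)
open import Function using (_∘_; const; flip; id; case_of_)
open import Level using (0ℓ)
open import Relation.Binary.PropositionalEquality
open import Relation.Nullary using (¬_; Dec; yes; no; does; contradiction)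
open import Relation.Nullary.Decidable using (toWitness)
open import Relation.Unary using (Pred; Decidable)
open import Defs

open +-*-Solver using (solve; _:=_; _:+_; _:*_; con)

-- Finite sums and counting over lists

⟦_⟧ : Bool → ℕ
⟦ true  ⟧ = 1
⟦ false ⟧ = 0

module _ {A : Set} where

  ∑ : List A → (A → ℕ) → ℕ
  ∑ []       f = 0
  ∑ (x ∷ xs) f = f x + ∑ xs f

  ∑-mono-∈ : ∀ xs {f g : A → ℕ} → (∀ {x} → x ∈ xs → f x ≤ g x) → ∑ xs f ≤ ∑ xs g
  ∑-mono-∈ []       f≤g = z≤n
  ∑-mono-∈ (x ∷ xs) f≤g = +-mono-≤ (f≤g (here refl)) (∑-mono-∈ xs (f≤g ∘ there))

  ∑-mono : ∀ xs {f g : A → ℕ} → (∀ x → f x ≤ g x) → ∑ xs f ≤ ∑ xs g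
  ∑-mono xs f≤g = ∑-mono-∈ xs (λ {x} _ → f≤g x)

  ∑-cong : ∀ xs {f g : A → ℕ} → (∀ x → f x ≡ g x) → ∑ xs f ≡ ∑ xs g
  ∑-cong []       f≡g = refl
  ∑-cong (x ∷ xs) f≡g = cong₂ _+_ (f≡g x) (∑-cong xs f≡g)

  ∑-zero : ∀ xs → ∑ xs (λ _ → 0) ≡ 0
  ∑-zero []       = refl
  ∑-zero (x ∷ xs) = ∑-zero xs

  ∑-+ : ∀ xs (f g : A → ℕ) → ∑ xs (λ x → f x + g x) ≡ ∑ xs f + ∑ xs g
  ∑-+ []       f g = refl
  ∑-+ (x ∷ xs) f g = trans (cong (f x + g x +_) (∑-+ xs f g))
    (solve 4 (λ a b c d → a :+ b :+ (c :+ d) := a :+ c :+ (b :+ d)) refl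
      (f x) (g x) (∑ xs f) (∑ xs g))

  ∑-*ˡ : ∀ xs c (f : A → ℕ) → ∑ xs (λ x → c * f x) ≡ c * ∑ xs f
  ∑-*ˡ []       c f = sym (*-zeroʳ c)
  ∑-*ˡ (x ∷ xs) c f =
    trans (cong (c * f x +_) (∑-*ˡ xs c f)) (sym (*-distribˡ-+ c (f x) (∑ xs f)))

  ∑-*ʳ : ∀ xs c (f : A → ℕ) → ∑ xs (λ x → f x * c) ≡ ∑ xs f * c
  ∑-*ʳ xs c f = trans (∑-cong xs (λ x → *-comm (f x) c))
                      (trans (∑-*ˡ xs c f) (*-comm c (∑ xs f)))

  ∑-const : ∀ xs c → ∑ xs (λ _ → c) ≡ length xs * c
  ∑-const []       c = refl
  ∑-const (x ∷ xs) c = cong (c +_) (∑-const xs c)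

  ∑-≤-const : ∀ xs {c} {f : A → ℕ} → (∀ {x} → x ∈ xs → f x ≤ c) → ∑ xs f ≤ length xs * c
  ∑-≤-const xs {c} f≤c = ≤-trans (∑-mono-∈ xs f≤c) (≤-reflexive (∑-const xs c))

  sum-map≡∑ : ∀ xs (f : A → ℕ) → sum (map f xs) ≡ ∑ xs f
  sum-map≡∑ []       f = refl
  sum-map≡∑ (x ∷ xs) f = cong (f x +_) (sum-map≡∑ xs f)

  length-filterᵇ : ∀ xs (p : A → Bool) → length (filterᵇ p xs) ≡ ∑ xs (⟦_⟧ ∘ p)
  length-filterᵇ []       p = refl
  length-filterᵇ (x ∷ xs) p with p x
  ... | true  = cong suc (length-filterᵇ xs p)
  ... | false = length-filterᵇ xs p

  module _ {P : Pred A 0ℓ} (P? : Decidable P) where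

    ∑-filter : ∀ xs (f : A → ℕ) →
      ∑ (filter P? xs) f ≡ ∑ xs (λ x → ⟦ does (P? x) ⟧ * f x)
    ∑-filter []       f = refl
    ∑-filter (x ∷ xs) f with P? x
    ... | yes _ = cong₂ _+_ (sym (*-identityˡ (f x))) (∑-filter xs f)
    ... | no  _ = ∑-filter xs f

    -- Each entry dropped by the filter costs at most `k`. The inequality is kept additive because
    -- subtraction in ℕ truncates; it does the density bookkeeping in `dense-core`.
    ∑-filter-bound : ∀ xs {k} (f : A → ℕ) → (∀ {x} → ¬ P x → f x ≤ k) →
      ∑ xs f + length (filter P? xs) * k ≤ ∑ (filter P? xs) f + length xs * k
    ∑-filter-bound [] f _ = z≤n
    ∑-filter-bound (x ∷ xs) {k} f low with P? x
    ... | yes _ = subst₂ _≤_ (shuffle (f x) (∑ xs f) k _) (shuffle (f x) _ k _)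
                    (+-monoʳ-≤ (f x + k) (∑-filter-bound xs f low))
      where
      shuffle : ∀ a b c d → a + c + (b + d) ≡ a + b + (c + d)
      shuffle = solve 4 (λ a b c d → a :+ c :+ (b :+ d) := a :+ b :+ (c :+ d)) refl
    ... | no ¬Px = subst₂ _≤_ (sym (+-assoc (f x) (∑ xs f) _)) (swap₃ k (∑ (filter P? xs) f) _)
                    (+-mono-≤ (low ¬Px) (∑-filter-bound xs f low))
      where
      swap₃ : ∀ a b c → a + (b + c) ≡ b + (a + c)
      swap₃ = solve 3 (λ a b c → a :+ (b :+ c) := b :+ (a :+ c)) refl

    -- Markov's inequality, used to bound the number of saturated vertices.
    length-filter*≤∑ : ∀ xs {k} (f : A → ℕ) → (∀ {x} → P x → k ≤ f x) →
      length (filter P? xs) * k ≤ ∑ xs f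
    length-filter*≤∑ []       f high = z≤n
    length-filter*≤∑ (x ∷ xs) f high with P? x
    ... | yes Px = +-mono-≤ (high Px) (length-filter*≤∑ xs f high)
    ... | no  _  = m≤n⇒m≤o+n (f x) (length-filter*≤∑ xs f high)

  -- All entries satisfying `P` are equal and `xs` has no repetitions, so at most one term survives.
  ∑-single : ∀ {xs} → Unique xs → {P : Pred A 0ℓ} (P? : Decidable P) →
    (∀ {x y} → P x → P y → x ≡ y) → ∀ {k} (f : A → ℕ) → (∀ x → f x ≤ k) →
    ∑ xs (λ x → ⟦ does (P? x) ⟧ * f x) ≤ k
  ∑-single [] P? P-prop f f≤k = z≤n
  ∑-single {x ∷ xs} (x∉xs ∷ uniq) P? P-prop {k} f f≤k with P? x
  ... | no  _  = ∑-single uniq P? P-prop f f≤k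
  ... | yes Px = subst (_≤ k)
    (sym (trans (cong₂ _+_ (*-identityˡ (f x)) (rest xs x∉xs)) (+-identityʳ (f x)))) (f≤k x)
    where
    rest : ∀ ys → All (x ≢_) ys → ∑ ys (λ y → ⟦ does (P? y) ⟧ * f y) ≡ 0
    rest []       []             = refl
    rest (y ∷ ys) (x≢y ∷ x∉ys) with P? y
    ... | yes Py = contradiction (P-prop Px Py) x≢y
    ... | no  _  = rest ys x∉ys

  -- Constructive averaging: `Q` stands for the existence of a good entry. Either a test finds one,
  -- or all tests fail and their inequalities add up. The conclusion has the shape of a test, so
  -- searches nest over two lists.
  search : ∀ {Q : Set} xs {k} (f g : A → ℕ) → (∀ x → Q ⊎ k * f x ≤ g x) →
    Q ⊎ k * ∑ xs f ≤ ∑ xs g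
  search []       {k} f g test = inj₂ (≤-reflexive (*-zeroʳ k))
  search (x ∷ xs) {k} f g test with test x | search xs {k} f g test
  ... | inj₁ q  | _       = inj₁ q
  ... | inj₂ _  | inj₁ q  = inj₁ q
  ... | inj₂ le | inj₂ ih = inj₂ (subst (_≤ g x + ∑ xs g) (sym (*-distribˡ-+ k (f x) (∑ xs f)))
                                    (+-mono-≤ le ih))

∑-swap : ∀ {A B : Set} (xs : List A) (ys : List B) (f : A → B → ℕ) →
  ∑ xs (λ x → ∑ ys (f x)) ≡ ∑ ys (λ y → ∑ xs (λ x → f x y))
∑-swap []       ys f = sym (∑-zero ys)
∑-swap (x ∷ xs) ys f = trans (cong (∑ ys (f x) +_) (∑-swap xs ys f))
                             (sym (∑-+ ys (f x) (λ y → ∑ xs (λ x′ → f x′ y))))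

length-filter-cover : ∀ {A : Set} {P Q : Pred A 0ℓ} (P? : Decidable P) (Q? : Decidable Q) →
  (∀ x → P x ⊎ Q x) → ∀ xs → length xs ≤ length (filter P? xs) + length (filter Q? xs)
length-filter-cover P? Q? total [] = z≤n
length-filter-cover P? Q? total (x ∷ xs) with P? x | Q? x | length-filter-cover P? Q? total xs
... | yes _ | yes _ | ih = s≤s (≤-trans ih (+-monoʳ-≤ _ (n≤1+n _)))
... | yes _ | no  _ | ih = s≤s ih
... | no  _ | yes _ | ih = ≤-trans (s≤s ih) (≤-reflexive (sym (+-suc _ _)))
... | no ¬p | no ¬q | ih with total x
...   | inj₁ p = contradiction p ¬p
...   | inj₂ q = contradiction q ¬q

-- The weighted sum over induced submatchings

Edge : ℕ → Set
Edge n = Fin n × Fin n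

module Potential {n : ℕ} (R : BipartiteGraph n) where

  infixl 6 _∖N_

  _∖N_ : (Fin n → Bool) → Fin n → Fin n → Bool
  (W ∖N a) b = W b ∧ not (R a b)

  -- The first term leaves the edge out of M′. The second takes it, which requires `b` to have
  -- avoided the neighbourhoods of all edges taken before. The weight 5 is chosen to exceed the
  -- product 2 * 2 of the two growth factors in `near-regular-bound`.
  extend : Edge n → ((Fin n → Bool) → ℕ) → (Fin n → Bool) → ℕ
  extend (a , b) Φ W = Φ W + ⟦ W b ⟧ * (5 * Φ (W ∖N a))

  -- The sum of 5^|M′| Φ(B ∖ N(M′)) over the M′ ⊆ M in which no edge ends at a
  -- neighbour of an edge chosen earlier; the head of M is the edge chosen last.
  Val : List (Edge n) → ((Fin n → Bool) → ℕ) → ℕ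
  Val []      Φ = Φ (const true)
  Val (e ∷ M) Φ = Val M (extend e Φ)

  Val-mono : ∀ M {Φ Ψ} → (∀ W → Φ W ≤ Ψ W) → Val M Φ ≤ Val M Ψ
  Val-mono []            Φ≤Ψ = Φ≤Ψ (const true)
  Val-mono ((a , b) ∷ M) Φ≤Ψ = Val-mono M (λ W →
    +-mono-≤ (Φ≤Ψ W) (*-monoʳ-≤ ⟦ W b ⟧ (*-monoʳ-≤ 5 (Φ≤Ψ (W ∖N a)))))

  Val-cong : ∀ M {Φ Ψ} → (∀ W → Φ W ≡ Ψ W) → Val M Φ ≡ Val M Ψ
  Val-cong M Φ≡Ψ = ≤-antisym (Val-mono M (≤-reflexive ∘ Φ≡Ψ))
                             (Val-mono M (≤-reflexive ∘ sym ∘ Φ≡Ψ))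

  -- `Val M` is linear because every `extend e` is. Together with `Val-mono` this moves a sum over
  -- the next edge inside `Val M`, where it can be estimated for each `W` separately.
  Val-+ : ∀ M Φ Ψ → Val M (λ W → Φ W + Ψ W) ≡ Val M Φ + Val M Ψ
  Val-+ []            Φ Ψ = refl
  Val-+ ((a , b) ∷ M) Φ Ψ = trans
    (Val-cong M (λ W → solve 5 (λ p q w p′ q′ →
        p :+ q :+ w :* (con 5 :* (p′ :+ q′)) :=
        (p :+ w :* (con 5 :* p′)) :+ (q :+ w :* (con 5 :* q′)))
      refl (Φ W) (Ψ W) ⟦ W b ⟧ (Φ (W ∖N a)) (Ψ (W ∖N a))))
    (Val-+ M (extend (a , b) Φ) (extend (a , b) Ψ))

  Val-* : ∀ M c Φ → Val M (λ W → c * Φ W) ≡ c * Val M Φ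
  Val-* []            c Φ = refl
  Val-* ((a , b) ∷ M) c Φ = trans
    (Val-cong M (λ W → solve 4 (λ c p w p′ →
        c :* p :+ w :* (con 5 :* (c :* p′)) := c :* (p :+ w :* (con 5 :* p′)))
      refl c (Φ W) ⟦ W b ⟧ (Φ (W ∖N a))))
    (Val-* M c (extend (a , b) Φ))

  Val-0 : ∀ M → Val M (λ _ → 0) ≡ 0
  Val-0 M = Val-* M 0 (λ _ → 0)

  Val-∑ : ∀ {A : Set} M (xs : List A) (Φ : A → (Fin n → Bool) → ℕ) →
    Val M (λ W → ∑ xs (λ x → Φ x W)) ≡ ∑ xs (λ x → Val M (Φ x))
  Val-∑ M []       Φ = Val-0 M
  Val-∑ M (x ∷ xs) Φ = trans (Val-+ M (Φ x) (λ W → ∑ xs (λ x′ → Φ x′ W)))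
                             (cong (Val M (Φ x) +_) (Val-∑ M xs Φ))

  -- The asymmetry reflects the order of choice: later list entries are chosen earlier, so the
  -- neighbourhood of the second edge has to avoid the B-end of the first.
  Separated : Edge n → Edge n → Set
  Separated (_ , b) (a′ , _) = ¬ T (R a′ b)

  -- Q collects the B-ends of the chosen edges that precede M.
  Val-lower : ∀ {P : Pred (Edge n) 0ℓ} (P? : Decidable P) M (Q : Fin n → Set) {Φ t} →
    (∀ W → (∀ {b} → Q b → T (W b)) → t ≤ Φ W) →
    (∀ {e} → e ∈ M → P e → ∀ {b} → Q b → ¬ T (R (proj₁ e) b)) →
    AllPairs (λ e e′ → P e → P e′ → Separated e e′) M →
    5 ^ length (filter P? M) * t ≤ Val M Φ
  Val-lower P? [] Q {Φ} {t} t≤Φ _ _ =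
    subst (_≤ Φ (const true)) (sym (*-identityˡ t)) (t≤Φ _ _)
  Val-lower {P} P? ((a , b) ∷ M) Q {Φ} {t} t≤Φ M-Q (e-M ∷ M-M) with P? (a , b)
  ... | no  _  = Val-lower P? M Q (λ W Q⊆W → m≤n⇒m≤n+o _ (t≤Φ W Q⊆W)) (M-Q ∘ there) M-M
  ... | yes Pe = subst (_≤ Val M (extend (a , b) Φ))
    (solve 2 (λ p t → p :* (con 5 :* t) := con 5 :* p :* t) refl (5 ^ length (filter P? M)) t)
    (Val-lower P? M Q′ gain (λ where
        e∈M Pe′ (inj₁ q)    → M-Q (there e∈M) Pe′ q
        e∈M Pe′ (inj₂ refl) → All.lookup e-M e∈M Pe Pe′) M-M)
    where
    Q′ : Fin n → Set
    Q′ b′ = Q b′ ⊎ b′ ≡ b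
    remain : ∀ W → (∀ {b′} → Q b′ → T (W b′)) → ∀ {b′} → Q b′ → T ((W ∖N a) b′)
    remain W Q⊆W {b′} q with W b′ | Q⊆W q | R a b′ | M-Q (here refl) Pe q
    ... | true | _ | true  | ¬R = ⊥-elim (¬R tt)
    ... | true | _ | false | _  = tt
    gain : ∀ W → (∀ {b′} → Q′ b′ → T (W b′)) → 5 * t ≤ extend (a , b) Φ W
    gain W Q′⊆W with W b | Q′⊆W (inj₂ refl)
    ... | true | _ = m≤n⇒m≤o+n (Φ W) (≤-trans
      (*-monoʳ-≤ 5 (t≤Φ (W ∖N a) (remain W (Q′⊆W ∘ inj₁))))
      (≤-reflexive (sym (*-identityˡ _))))

  module _ (y : ℕ) where

    -- This is (1 + 1/y)^r multiplied by y^|Y| to stay in ℕ, where r counts the entries of `Y` that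
    -- lie in `W`.
    weight : List (Fin n) → (Fin n → Bool) → ℕ
    weight []      W = 1
    weight (b ∷ Y) W = (⟦ W b ⟧ + y) * weight Y W

    weight-true : ∀ Y → weight Y (const true) ≡ suc y ^ length Y
    weight-true []      = refl
    weight-true (b ∷ Y) = cong (suc y *_) (weight-true Y)

    weight-lower : ∀ Y W → y ^ length Y ≤ weight Y W
    weight-lower []      W = ≤-refl
    weight-lower (b ∷ Y) W = *-mono-≤ (m≤n+m y ⟦ W b ⟧) (weight-lower Y W)

    -- Bernoulli: (1 + 1/y) ^ x ≥ 1 + x/y, where x counts the neighbours of a in W.
    weight-drop : ∀ Y W a →
      (y + ∑ Y (λ b → ⟦ R a b ⟧ * ⟦ W b ⟧)) * weight Y (W ∖N a) ≤ y * weight Y W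
    weight-drop []      W a = ≤-reflexive (cong (_* 1) (+-identityʳ y))
    weight-drop (b ∷ Y) W a with R a b | W b | weight-drop Y W a
    ... | r | w | ih = cases r w
      where
      open ≤-Reasoning
      x = ∑ Y (λ b → ⟦ R a b ⟧ * ⟦ W b ⟧)
      v = weight Y W
      v′ = weight Y (W ∖N a)
      scale : ∀ k → (y + x) * (k * v′) ≤ y * (k * v)
      scale k = begin
        (y + x) * (k * v′) ≡⟨ solve 3 (λ a k v → a :* (k :* v) := k :* (a :* v)) refl (y + x) k v′ ⟩
        k * ((y + x) * v′) ≤⟨ *-monoʳ-≤ k ih ⟩
        k * (y * v)        ≡⟨ solve 3 (λ a k v → k :* (a :* v) := a :* (k :* v)) refl y k v ⟩
        y * (k * v)        ∎
      cases : ∀ r w → (y + (⟦ r ⟧ * ⟦ w ⟧ + x)) * ((⟦ w ∧ not r ⟧ + y) * v′) ≤ y * ((⟦ w ⟧ + y) * v)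
      cases true  false = scale y
      cases false true  = scale (suc y)
      cases false false = scale y
      -- Here `b` leaves `W`: one factor falls from `suc y` to `y` while the neighbour count rises
      -- by one. The extra `y * v′` is paid for by the induction hypothesis with `x` dropped.
      cases true  true  = begin
        (y + suc x) * (y * v′)
          ≡⟨ solve 3 (λ y x v → (y :+ (con 1 :+ x)) :* (y :* v) :=
               y :* ((y :+ x) :* v) :+ y :* v) refl y x v′ ⟩
        y * ((y + x) * v′) + y * v′
          ≤⟨ +-mono-≤ (*-monoʳ-≤ y ih) (≤-trans (*-monoˡ-≤ v′ (m≤m+n y x)) ih) ⟩
        y * (y * v) + y * v
          ≡⟨ solve 2 (λ y v → y :* (y :* v) :+ y :* v := y :* ((con 1 :+ y) :* v)) refl y v ⟩
        y * (suc y * v) ∎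

    -- If `a` has x neighbours in `W`, taking one of its edges offers at most x choices, but the
    -- weight shrinks so much that x times the new weight is at most `y` times the old one
    -- (`weight-drop`). Hence each `a` adds at most `5 * y` weights, whatever its degree.
    extend-total : ∀ X Y (ω : BipartiteGraph n) → (∀ a b → ⟦ ω a b ⟧ ≤ ⟦ R a b ⟧) → ∀ W →
      ∑ X (λ a → ∑ Y (λ b → ⟦ ω a b ⟧ * extend (a , b) (weight Y) W)) ≤
      (∑ X (λ a → ∑ Y (λ b → ⟦ ω a b ⟧)) + length X * (5 * y)) * weight Y W
    extend-total X Y ω ω≤R W = begin
      ∑ X (λ a → ∑ Y (λ b → ⟦ ω a b ⟧ * extend (a , b) (weight Y) W))
        ≤⟨ ∑-mono X row ⟩
      ∑ X (λ a → (∑ Y (λ b → ⟦ ω a b ⟧) + 5 * y) * v)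
        ≡⟨ ∑-*ʳ X v _ ⟩
      ∑ X (λ a → ∑ Y (λ b → ⟦ ω a b ⟧) + 5 * y) * v
        ≡⟨ cong (_* v) (trans (∑-+ X _ _) (cong (∑ X (λ a → ∑ Y (λ b → ⟦ ω a b ⟧)) +_) (∑-const X (5 * y)))) ⟩
      (∑ X (λ a → ∑ Y (λ b → ⟦ ω a b ⟧)) + length X * (5 * y)) * v ∎
      where
      open ≤-Reasoning
      v = weight Y W
      row : ∀ a → ∑ Y (λ b → ⟦ ω a b ⟧ * extend (a , b) (weight Y) W) ≤
                  (∑ Y (λ b → ⟦ ω a b ⟧) + 5 * y) * v
      row a = begin
        ∑ Y (λ b → ⟦ ω a b ⟧ * (v + ⟦ W b ⟧ * (5 * v′)))
          ≡⟨ ∑-cong Y (λ b → solve 4 (λ o v w v′ → o :* (v :+ w :* (con 5 :* v′)) :=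
               o :* v :+ o :* w :* (con 5 :* v′)) refl ⟦ ω a b ⟧ v ⟦ W b ⟧ v′) ⟩
        ∑ Y (λ b → ⟦ ω a b ⟧ * v + ⟦ ω a b ⟧ * ⟦ W b ⟧ * (5 * v′))
          ≡⟨ ∑-+ Y _ _ ⟩
        ∑ Y (λ b → ⟦ ω a b ⟧ * v) + ∑ Y (λ b → ⟦ ω a b ⟧ * ⟦ W b ⟧ * (5 * v′))
          ≡⟨ cong₂ _+_ (∑-*ʳ Y v _) (∑-*ʳ Y (5 * v′) _) ⟩
        d * v + ∑ Y (λ b → ⟦ ω a b ⟧ * ⟦ W b ⟧) * (5 * v′)
          ≤⟨ +-monoʳ-≤ (d * v) (*-monoˡ-≤ (5 * v′)
               (∑-mono Y (λ b → *-monoˡ-≤ ⟦ W b ⟧ (ω≤R a b)))) ⟩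
        d * v + x * (5 * v′)
          ≡⟨ solve 4 (λ d v x v′ → d :* v :+ x :* (con 5 :* v′) :=
               d :* v :+ con 5 :* (x :* v′)) refl d v x v′ ⟩
        d * v + 5 * (x * v′)
          ≤⟨ +-monoʳ-≤ (d * v) (*-monoʳ-≤ 5 (≤-trans (*-monoˡ-≤ v′ (m≤n+m x y)) (weight-drop Y W a))) ⟩
        d * v + 5 * (y * v)
          ≡⟨ solve 3 (λ d v y → d :* v :+ con 5 :* (y :* v) := (d :+ con 5 :* y) :* v) refl d v y ⟩
        (d + 5 * y) * v ∎
        where
        v′ = weight Y (W ∖N a)
        d  = ∑ Y (λ b → ⟦ ω a b ⟧)
        x  = ∑ Y (λ b → ⟦ R a b ⟧ * ⟦ W b ⟧)

-- Membership of edges in lists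

_≟ᵉ_ : ∀ {n} (e e′ : Edge n) → Dec (e ≡ e′)
_≟ᵉ_ = ≡-dec Fin._≟_ Fin._≟_

_∈?_ : ∀ {n} (e : Edge n) M → Dec (e ∈ M)
_∈?_ = DecMembership._∈?_ _≟ᵉ_

-- Double counting of equal pairs: every entry of `xs` occurs in `ys`, and an entry of `ys` equals
-- at most one entry of `xs`. It connects the list M′ given by a multitasker with the filtered list
-- in `Val-lower`.
unique⇒length≤ : ∀ {n} {xs ys : List (Edge n)} → Unique xs → xs ⊆ ys →
  length xs ≤ length (filter (_∈? xs) ys)
unique⇒length≤ {xs = xs} {ys} uniq xs⊆ys = begin
  length xs                                  ≡⟨ *-identityʳ _ ⟨
  length xs * 1                              ≡⟨ ∑-const xs 1 ⟨
  ∑ xs (λ _ → 1)                             ≤⟨ ∑-mono-∈ xs (λ x∈xs → hit ys (xs⊆ys x∈xs)) ⟩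
  ∑ xs (λ x → ∑ ys (λ y → same x y))         ≡⟨ ∑-swap xs ys same ⟩
  ∑ ys (λ y → ∑ xs (λ x → same x y))         ≤⟨ ∑-mono ys column ⟩
  ∑ ys (λ y → ⟦ does (y ∈? xs) ⟧ * 1)        ≡⟨ ∑-filter (_∈? xs) ys (λ _ → 1) ⟨
  ∑ (filter (_∈? xs) ys) (λ _ → 1)           ≡⟨ ∑-const (filter (_∈? xs) ys) 1 ⟩
  length (filter (_∈? xs) ys) * 1            ≡⟨ *-identityʳ _ ⟩
  length (filter (_∈? xs) ys)                ∎
  where
  open ≤-Reasoning
  same = λ x y → ⟦ does (x ≟ᵉ y) ⟧ * 1
  hit : ∀ ys {x} → x ∈ ys → 1 ≤ ∑ ys (same x)
  hit (y ∷ ys) {x} (here x≡y) with x ≟ᵉ y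
  ... | yes _  = s≤s z≤n
  ... | no x≢y = contradiction x≡y x≢y
  hit (y ∷ ys) (there x∈ys) = m≤n⇒m≤o+n _ (hit ys x∈ys)
  column : ∀ y → ∑ xs (λ x → same x y) ≤ ⟦ does (y ∈? xs) ⟧ * 1
  column y with y ∈? xs
  ... | yes _ = ∑-single uniq (_≟ᵉ y) (λ p q → trans p (sym q)) (λ _ → 1) (λ _ → ≤-refl)
  ... | no y∉xs = ≤-trans (∑-≤-const xs miss) (≤-reflexive (*-zeroʳ (length xs)))
    where
    miss : ∀ {x} → x ∈ xs → same x y ≤ 0
    miss {x} x∈xs with x ≟ᵉ y
    ... | yes refl = contradiction x∈xs y∉xs
    ... | no  _    = z≤n

-- Greedy choice of a matching of low potential

edges : ∀ {n} → BipartiteGraph n → List (Fin n) → List (Fin n) → ℕ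
edges G X Y = ∑ X (λ a → ∑ Y (λ b → ⟦ G a b ⟧))

module Greedy {n : ℕ} (R : BipartiteGraph n) where
  open Potential R

  free : List (Edge n) → BipartiteGraph n
  free []              a b = R a b
  free ((a₀ , b₀) ∷ M) a b = free M a b ∧ (not (does (a Fin.≟ a₀)) ∧ not (does (b Fin.≟ b₀)))

  free-sound : ∀ M {a b} → T (free M a b) → T (R a b) × All (NoSharedVertex R (a , b)) M
  free-sound []              r = r , []
  free-sound ((a₀ , b₀) ∷ M) {a} {b} r with free M a b | free-sound M {a} {b} | a Fin.≟ a₀ | b Fin.≟ b₀
  ... | true | sound | no a≢ | no b≢ = proj₁ (sound tt) , (a≢ , b≢) ∷ proj₂ (sound tt)

  free≤R : ∀ M a b → ⟦ free M a b ⟧ ≤ ⟦ R a b ⟧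
  free≤R M a b with free M a b | R a b | free-sound M {a} {b}
  ... | false | _     | _     = z≤n
  ... | true  | true  | _     = ≤-refl
  ... | true  | false | sound = ⊥-elim (proj₁ (sound tt))

  -- A new matching edge blocks only the edges of `R` at its two ends, at most `c` at each.
  free-count : ∀ {X Y c} → Unique X → Unique Y →
    (∀ a → ∑ Y (λ b → ⟦ R a b ⟧) ≤ c) → (∀ b → ∑ X (λ a → ⟦ R a b ⟧) ≤ c) →
    ∀ M → edges R X Y ≤ edges (free M) X Y + length M * (c + c)
  free-count uX uY dA dB [] = ≤-reflexive (sym (+-identityʳ _))
  free-count {X} {Y} {c} uX uY dA dB ((a₀ , b₀) ∷ M) = begin
    edges R X Y
      ≤⟨ free-count uX uY dA dB M ⟩
    edges (free M) X Y + k
      ≤⟨ +-monoˡ-≤ k (∑-mono X (λ a → ∑-mono Y (split a))) ⟩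
    ∑ X (λ a → ∑ Y (λ b → ⟦ free M′ a b ⟧ + (atA a b + atB a b))) + k
      ≡⟨ cong (_+ k) (trans (∑-cong X (λ a → trans (∑-+ Y _ _) (cong (∑ Y (λ b → ⟦ free M′ a b ⟧) +_) (∑-+ Y (atA a) (atB a)))))
           (trans (∑-+ X (λ a → ∑ Y (λ b → ⟦ free M′ a b ⟧)) _)
                  (cong (edges (free M′) X Y +_) (∑-+ X (λ a → ∑ Y (atA a)) (λ a → ∑ Y (atB a)))))) ⟩
    edges (free M′) X Y + (∑ X (λ a → ∑ Y (atA a)) + ∑ X (λ a → ∑ Y (atB a))) + k
      ≤⟨ +-monoˡ-≤ k (+-monoʳ-≤ (edges (free M′) X Y) (+-mono-≤ lossA lossB)) ⟩
    edges (free M′) X Y + (c + c) + k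
      ≡⟨ +-assoc (edges (free M′) X Y) (c + c) k ⟩
    edges (free M′) X Y + (c + c + k) ∎
    where
    open ≤-Reasoning
    M′ = (a₀ , b₀) ∷ M
    k  = length M * (c + c)
    atA atB : Fin n → Fin n → ℕ
    atA a b = ⟦ does (a Fin.≟ a₀) ⟧ * ⟦ R a b ⟧
    atB a b = ⟦ does (b Fin.≟ b₀) ⟧ * ⟦ R a b ⟧
    split : ∀ a b → ⟦ free M a b ⟧ ≤ ⟦ free M′ a b ⟧ + (atA a b + atB a b)
    split a b with free M a b | free≤R M a b | a Fin.≟ a₀ | b Fin.≟ b₀
    ... | false | _  | _     | _     = z≤n
    ... | true  | le | no  _ | no  _ = s≤s z≤n
    ... | true  | le | yes _ | _     = ≤-trans le (m≤n⇒m≤n+o _ (≤-reflexive (sym (*-identityˡ _))))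
    ... | true  | le | no  _ | yes _ = ≤-trans le (≤-reflexive (sym (*-identityˡ _)))
    lossA : ∑ X (λ a → ∑ Y (atA a)) ≤ c
    lossA = ≤-trans (≤-reflexive (∑-cong X (λ a → ∑-*ˡ Y ⟦ does (a Fin.≟ a₀) ⟧ (λ b → ⟦ R a b ⟧))))
      (∑-single uX (Fin._≟ a₀) (λ p q → trans p (sym q)) _ dA)
    lossB : ∑ X (λ a → ∑ Y (atB a)) ≤ c
    lossB = ≤-trans (≤-reflexive (trans (∑-swap X Y atB)
        (∑-cong Y (λ b → ∑-*ˡ X ⟦ does (b Fin.≟ b₀) ⟧ (λ a → ⟦ R a b ⟧)))))
      (∑-single uY (Fin._≟ b₀) (λ p q → trans p (sym q)) _ dB)

  module _ {X Y : List (Fin n)} {c : ℕ} (uX : Unique X) (uY : Unique Y)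
    (dA : ∀ a → ∑ Y (λ b → ⟦ R a b ⟧) ≤ c) (dB : ∀ b → ∑ X (λ a → ⟦ R a b ⟧) ≤ c)
    (y s N z : ℕ) (1≤N : 1 ≤ N) (enough : N + s * (c + c) ≤ edges R X Y)
    (z-bound : length X * (5 * y) ≤ z)
    where

    private
      wt = weight y Y

    -- Some free edge does no worse than the average. There are at least `N` free edges, so by
    -- `extend-total` the average growth factor is at most 1 + z/N.
    grow : ∀ M → length M ≤ s →
      ∃₂ λ a b → T (free M a b) × N * Val ((a , b) ∷ M) wt ≤ (N + z) * Val M wt
    -- In ℕ a failed test means at least `suc K`; this surplus makes the final comparison with
    -- `K * F` strict, since `F` is positive.
    grow M |M|≤s with search X {suc ((N + z) * Val M wt)} _ _ (λ a → search Y {suc ((N + z) * Val M wt)} (λ b → ⟦ free M a b ⟧)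
        (λ b → ⟦ free M a b ⟧ * (N * Val ((a , b) ∷ M) wt)) (test a))
      where
      K = (N + z) * Val M wt
      Q = ∃₂ λ a b → T (free M a b) × N * Val ((a , b) ∷ M) wt ≤ K
      test : ∀ a b → Q ⊎ suc K * ⟦ free M a b ⟧ ≤ ⟦ free M a b ⟧ * (N * Val ((a , b) ∷ M) wt)
      test a b with free M a b in eq | N * Val ((a , b) ∷ M) wt ≤? K
      ... | false | _      = inj₂ (≤-reflexive (*-zeroʳ K))
      ... | true  | yes le = inj₁ (a , b , subst T (sym eq) tt , le)
      ... | true  | no  gt = inj₂ (subst₂ _≤_ (sym (*-identityʳ (suc K))) (sym (*-identityˡ _)) (≰⇒> gt))
    ... | inj₁ found = found
    ... | inj₂ big   = contradiction (begin-strict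
      K * F                      <⟨ m<n+m (K * F) (≤-trans 1≤N N≤F) ⟩
      suc K * F                  ≤⟨ big ⟩
      ∑ X (λ a → ∑ Y (λ b → ⟦ free M a b ⟧ * (N * Val ((a , b) ∷ M) wt)))
        ≡⟨ ∑-cong X (λ a → ∑-cong Y (λ b → trans (cong (⟦ free M a b ⟧ *_)
             (sym (Val-* M N (extend (a , b) wt)))) (sym (Val-* M ⟦ free M a b ⟧ _)))) ⟩
      ∑ X (λ a → ∑ Y (λ b → Val M (λ W → ⟦ free M a b ⟧ * (N * extend (a , b) wt W))))
        ≡⟨ trans (∑-cong X (λ a → sym (Val-∑ M Y _))) (sym (Val-∑ M X _)) ⟩
      Val M (λ W → ∑ X (λ a → ∑ Y (λ b → ⟦ free M a b ⟧ * (N * extend (a , b) wt W))))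
        ≤⟨ Val-mono M (λ W → ≤-trans (≤-reflexive (pull W))
             (*-monoʳ-≤ N (extend-total y X Y (free M) (free≤R M) W))) ⟩
      Val M (λ W → N * ((F + length X * (5 * y)) * wt W))
        ≡⟨ trans (Val-* M N _) (cong (N *_) (Val-* M (F + length X * (5 * y)) wt)) ⟩
      N * ((F + length X * (5 * y)) * V)
        ≤⟨ *-monoʳ-≤ N (*-monoˡ-≤ V (+-monoʳ-≤ F z-bound)) ⟩
      N * ((F + z) * V)
        ≡⟨ solve 4 (λ N F z V → N :* ((F :+ z) :* V) := N :* F :* V :+ N :* z :* V) refl N F z V ⟩
      N * F * V + N * z * V
        ≤⟨ +-monoʳ-≤ (N * F * V) (*-monoˡ-≤ V (*-monoˡ-≤ z N≤F)) ⟩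
      N * F * V + F * z * V
        ≡⟨ solve 4 (λ N F z V → N :* F :* V :+ F :* z :* V := (N :+ z) :* V :* F) refl N F z V ⟩
      K * F ∎) (<-irrefl refl)
      where
      open ≤-Reasoning
      V = Val M wt
      K = (N + z) * V
      F = edges (free M) X Y
      N≤F : N ≤ F
      N≤F = +-cancelʳ-≤ (s * (c + c)) N F (begin
        N + s * (c + c)           ≤⟨ enough ⟩
        edges R X Y               ≤⟨ free-count uX uY dA dB M ⟩
        F + length M * (c + c)    ≤⟨ +-monoʳ-≤ F (*-monoˡ-≤ (c + c) |M|≤s) ⟩
        F + s * (c + c)           ∎)
      pull : ∀ W → ∑ X (λ a → ∑ Y (λ b → ⟦ free M a b ⟧ * (N * extend (a , b) wt W))) ≡
                   N * ∑ X (λ a → ∑ Y (λ b → ⟦ free M a b ⟧ * extend (a , b) wt W))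
      pull W = trans (∑-cong X (λ a → trans
        (∑-cong Y (λ b → solve 3 (λ f N e → f :* (N :* e) := N :* (f :* e)) refl
          ⟦ free M a b ⟧ N (extend (a , b) wt W)))
        (∑-*ˡ Y N _))) (∑-*ˡ X N _)

    -- Iterating `grow` from the empty matching, whose potential is `suc y ^ length Y`; the
    -- denominators `N ^ j` are cleared.
    low-potential-matching : ∀ j → j ≤ s → ∃ λ M → length M ≡ j × IsMatching R M ×
      N ^ j * Val M wt ≤ (N + z) ^ j * suc y ^ length Y
    low-potential-matching zero    _   =
      [] , refl , ([] , []) , +-monoˡ-≤ 0 (≤-reflexive (weight-true y Y))
    low-potential-matching (suc j) j<s with low-potential-matching j (<⇒≤ j<s)
    ... | M , refl , (edge , apart) , low with grow M (<⇒≤ j<s)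
    ... | a , b , isFree , step with free-sound M isFree
    ... | isEdge , new = (a , b) ∷ M , refl , (isEdge ∷ edge , new ∷ apart) , (begin
      N * P * Val ((a , b) ∷ M) wt       ≡⟨ left N P _ ⟩
      P * (N * Val ((a , b) ∷ M) wt)     ≤⟨ *-monoʳ-≤ P step ⟩
      P * ((N + z) * Val M wt)           ≡⟨ left (N + z) P _ ⟨
      (N + z) * P * Val M wt             ≡⟨ *-assoc (N + z) P _ ⟩
      (N + z) * (P * Val M wt)           ≤⟨ *-monoʳ-≤ (N + z) low ⟩
      (N + z) * ((N + z) ^ length M * suc y ^ length Y) ≡⟨ *-assoc (N + z) _ _ ⟨
      (N + z) * (N + z) ^ length M * suc y ^ length Y   ∎)
      where
      open ≤-Reasoning
      P = N ^ length M
      left : ∀ a p v → a * p * v ≡ p * (a * v)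
      left = solve 3 (λ a p v → a :* p :* v := p :* (a :* v)) refl

-- Estimates for powers of 1 + 1/x

-- (1 + 1/x)ᵖ ≤ 1 / (1 - p/x).
power-growth : ∀ d p → suc (d + p) ^ p * d ≤ (d + p) ^ p * (d + p)
power-growth d zero    = ≤-reflexive (cong (1 *_) (sym (+-identityʳ d)))
power-growth d (suc p) rewrite +-suc d p = begin
  suc x * suc x ^ p * d            ≤⟨ m≤m+n _ (suc x ^ p * suc p) ⟩
  suc x * suc x ^ p * d + suc x ^ p * suc p
    ≡⟨ solve 3 (λ d p u → (con 2 :+ (d :+ p)) :* u :* d :+ u :* (con 1 :+ p) :=
         (con 1 :+ (d :+ p)) :* (u :* (con 1 :+ d))) refl d p (suc x ^ p) ⟩
  x * (suc x ^ p * suc d)          ≤⟨ *-monoʳ-≤ x (power-growth (suc d) p) ⟩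
  x * (x ^ p * x)                  ≡⟨ *-assoc x (x ^ p) x ⟨
  x * x ^ p * x                    ∎
  where
  open ≤-Reasoning
  x = suc (d + p)

-- With p at most x/2, the bound 1 / (1 - p/x) of `power-growth` is at most 2.
doubling : ∀ x p .{{_ : NonZero x}} → p + p ≤ x → suc x ^ p ≤ 2 * x ^ p
doubling x p 2p≤x with m≤n⇒∃[o]m+o≡n (≤-trans (m≤m+n p p) 2p≤x)
... | d , refl = *-cancelʳ-≤ _ _ (p + d) (begin
  suc (p + d) ^ p * (p + d)            ≡⟨ cong (λ x → suc x ^ p * x) (+-comm p d) ⟩
  suc (d + p) ^ p * (d + p)            ≤⟨ *-monoʳ-≤ (suc (d + p) ^ p) (+-monoʳ-≤ d p≤d) ⟩
  suc (d + p) ^ p * (d + d)            ≡⟨ *-distribˡ-+ (suc (d + p) ^ p) d d ⟩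
  suc (d + p) ^ p * d + suc (d + p) ^ p * d
    ≤⟨ +-mono-≤ (power-growth d p) (power-growth d p) ⟩
  (d + p) ^ p * (d + p) + (d + p) ^ p * (d + p)
    ≡⟨ solve 2 (λ u x → u :* x :+ u :* x := con 2 :* u :* x) refl ((d + p) ^ p) (d + p) ⟩
  2 * (d + p) ^ p * (d + p)            ≡⟨ cong (λ x → 2 * x ^ p * x) (+-comm d p) ⟩
  2 * (p + d) ^ p * (p + d)            ∎)
  where
  open ≤-Reasoning
  p≤d : p ≤ d
  p≤d = +-cancelˡ-≤ p p d 2p≤x

^-distribʳ-* : ∀ k x y → (x * y) ^ k ≡ x ^ k * y ^ k
^-distribʳ-* zero    x y = refl
^-distribʳ-* (suc k) x y = trans (cong (x * y *_) (^-distribʳ-* k x y))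
  (solve 4 (λ x y u v → x :* y :* (u :* v) := x :* u :* (y :* v)) refl x y (x ^ k) (y ^ k))

-- The k-th power of `doubling`. The exponent `s` is first padded to exactly `p * k`, and the
-- padding is cancelled at the end.
power-ratio : ∀ x p k s .{{_ : NonZero x}} → p + p ≤ x → s ≤ p * k → suc x ^ s ≤ 2 ^ k * x ^ s
power-ratio x p k s 2p≤x s≤pk with m≤n⇒∃[o]m+o≡n s≤pk
... | r , s+r≡pk = *-cancelʳ-≤ _ _ (x ^ r) {{m^n≢0 x r}} (begin
  suc x ^ s * x ^ r        ≤⟨ *-monoʳ-≤ (suc x ^ s) (^-monoˡ-≤ r (n≤1+n x)) ⟩
  suc x ^ s * suc x ^ r    ≡⟨ ^-distribˡ-+-* (suc x) s r ⟨
  suc x ^ (s + r)          ≡⟨ cong (suc x ^_) s+r≡pk ⟩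
  suc x ^ (p * k)          ≡⟨ ^-*-assoc (suc x) p k ⟨
  (suc x ^ p) ^ k          ≤⟨ ^-monoˡ-≤ k (doubling x p 2p≤x) ⟩
  (2 * x ^ p) ^ k          ≡⟨ ^-distribʳ-* k 2 (x ^ p) ⟩
  2 ^ k * (x ^ p) ^ k      ≡⟨ cong (2 ^ k *_) (^-*-assoc x p k) ⟩
  2 ^ k * x ^ (p * k)      ≡⟨ cong (λ e → 2 ^ k * x ^ e) s+r≡pk ⟨
  2 ^ k * x ^ (s + r)      ≡⟨ cong (2 ^ k *_) (^-distribˡ-+-* x s r) ⟩
  2 ^ k * (x ^ s * x ^ r)  ≡⟨ *-assoc (2 ^ k) (x ^ s) (x ^ r) ⟨
  2 ^ k * x ^ s * x ^ r    ∎)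
  where open ≤-Reasoning

-- Nearly regular subgraphs

-- The combinatorial part runs over ℕ, with `h` in the role of 1/α.
Multitasks : ∀ {n} → ℕ → BipartiteGraph n → Set
Multitasks h G = ∀ M → IsMatching G M →
  ∃ λ M′ → IsMatching G M′ × M′ ⊆ M × IsInduced G M′ × length M ≤ h * length M′

-- Opaque because multiplication by a large literal unfolds in unary.
opaque
  κ : ℕ
  κ = 2560

  κ≡ : κ ≡ 2560
  κ≡ = refl

-- The greedy matching has `s` edges, so its induced part has size k with s ≤ hk. Both growth
-- factors, (1 + 1/(2h))^s from the choices and (1 + 1/y)^|Y| from the initial potential, are then
-- at most 2^k, while the induced part alone contributes 5^k.
near-regular-bound : ∀ {n} (G R : BipartiteGraph n) h .{{_ : NonZero h}} → Multitasks h G →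
  (∀ {a b} → T (R a b) → T (G a b)) →
  ∀ {X Y m c} → Unique X → Unique Y → length X ≤ m → length Y ≤ m → 1 ≤ m →
  (∀ a → ∑ Y (λ b → ⟦ R a b ⟧) ≤ c) → (∀ b → ∑ X (λ a → ⟦ R a b ⟧) ≤ c) →
  κ * (h * h) ≡ c → ¬ (c * m ≤ 2 * edges R X Y)
near-regular-bound {n} G R h mt R⊆G {X} {Y} {m} {c} uX uY |X|≤m |Y|≤m 1≤m dA dB c≡ dense =
  contradiction (^-monoˡ-< k 4<5) (≤⇒≯ 5^k≤4^k)
  where
  open ≤-Reasoning
  open Potential R
  open Greedy R
  s y z N : ℕ
  -- At most `s * (c + c)` ≤ cm/4 edges get blocked, half of the available cm/2. The rest leaves
  -- room for `N`, which equals `2 * (c * s)`. As |X| ≤ 16s, `z` dominates `length X * (5 * y)` with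
  -- κ = 16 * 5 * 32, and z/N = 1/(2h).
  s = m / 8
  y = 32 * h
  z = κ * (h * s)
  N = 2 * h * z
  1≤h : 1 ≤ h
  1≤h = >-nonZero⁻¹ h
  instance
    κ≢0 : NonZero κ
    κ≢0 = subst NonZero (sym κ≡) _
    y≢0 : NonZero y
    y≢0 = m*n≢0 32 h
    2h≢0 : NonZero (2 * h)
    2h≢0 = m*n≢0 2 h
    m≢0 : NonZero m
    m≢0 = >-nonZero 1≤m
  m≡ : m ≡ m % 8 + s * 8
  m≡ = m≡m%n+[m/n]*n m 8
  8≤m : 8 ≤ m
  -- At most m² edges exist, so density forces c ≤ 2m, whereas c ≥ κ ≥ 16. This ensures that `s` is
  -- not rounded down to 0.
  8≤m = *-cancelˡ-≤ 2 (begin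
    16              ≤⟨ subst (16 ≤_) (sym κ≡) (≤ᵇ⇒≤ 16 2560 tt) ⟩
    κ               ≡⟨ *-identityʳ κ ⟨
    κ * (1 * 1)     ≤⟨ *-monoʳ-≤ κ (*-mono-≤ 1≤h 1≤h) ⟩
    κ * (h * h)     ≡⟨ c≡ ⟩
    c               ≤⟨ *-cancelʳ-≤ c (2 * m) m (begin
      c * m               ≤⟨ dense ⟩
      2 * edges R X Y     ≤⟨ *-monoʳ-≤ 2 (∑-≤-const X (λ {a} _ → ∑-≤-const Y (λ {b} _ → ⟦⟧≤1 (R a b)))) ⟩
      2 * (length X * (length Y * 1)) ≤⟨ *-monoʳ-≤ 2 (*-mono-≤ |X|≤m (*-monoˡ-≤ 1 |Y|≤m)) ⟩
      2 * (m * (m * 1))   ≡⟨ solve 1 (λ m → con 2 :* (m :* (m :* con 1)) := con 2 :* m :* m) refl m ⟩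
      2 * m * m           ∎) ⟩
    2 * m           ∎)
    where
    ⟦⟧≤1 : ∀ r → ⟦ r ⟧ ≤ 1
    ⟦⟧≤1 true  = ≤-refl
    ⟦⟧≤1 false = z≤n
  1≤s : 1 ≤ s
  1≤s = m≥n⇒m/n>0 8≤m
  m≤16s : m ≤ 16 * s
  m≤16s = begin
    m                ≡⟨ m≡ ⟩
    m % 8 + s * 8    ≤⟨ +-monoˡ-≤ (s * 8) (≤-trans (<⇒≤ (m%n<n m 8)) (*-monoˡ-≤ 8 1≤s)) ⟩
    s * 8 + s * 8    ≡⟨ solve 1 (λ s → s :* con 8 :+ s :* con 8 := con 16 :* s) refl s ⟩
    16 * s           ∎
  1≤z : 1 ≤ z
  1≤z = ≤-trans (*-mono-≤ 1≤h 1≤s) (m≤n*m (h * s) κ)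
  1≤N : 1 ≤ N
  1≤N = ≤-trans 1≤z (m≤n*m z (2 * h))
  enough : N + s * (c + c) ≤ edges R X Y
  enough = *-cancelˡ-≤ 2 (begin
    2 * (N + s * (c + c))   ≡⟨ cong (λ N → 2 * (N + s * (c + c))) N≡ ⟩
    2 * (2 * (c * s) + s * (c + c))
      ≡⟨ solve 2 (λ c s → con 2 :* (con 2 :* (c :* s) :+ s :* (c :+ c)) := c :* (s :* con 8)) refl c s ⟩
    c * (s * 8)             ≤⟨ *-monoʳ-≤ c (m/n*n≤m m 8) ⟩
    c * m                   ≤⟨ dense ⟩
    2 * edges R X Y         ∎)
    where
    N≡ : N ≡ 2 * (c * s)
    N≡ = trans (solve 3 (λ K h s → con 2 :* h :* (K :* (h :* s)) := con 2 :* (K :* (h :* h) :* s))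
                 refl κ h s)
               (cong (λ c → 2 * (c * s)) c≡)
  z-bound : length X * (5 * y) ≤ z
  z-bound = begin
    length X * (5 * y)        ≤⟨ *-monoˡ-≤ (5 * y) (≤-trans |X|≤m m≤16s) ⟩
    16 * s * (5 * (32 * h))
      ≡⟨ solve 5 (λ p q r h s → p :* s :* (q :* (r :* h)) := p :* (q :* r) :* (h :* s)) refl 16 5 32 h s ⟩
    16 * (5 * 32) * (h * s)   ≡⟨ cong (_* (h * s)) κ≡ ⟨
    κ * (h * s)               ∎
  matching : ∃ λ M → length M ≡ s × IsMatching R M ×
    N ^ s * Val M (weight y Y) ≤ (N + z) ^ s * suc y ^ length Y
  matching = low-potential-matching uX uY dA dB y s N z 1≤N enough z-bound s ≤-refl
  M = proj₁ matching
  |M|≡s = proj₁ (proj₂ matching)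
  edgesM = proj₁ (proj₁ (proj₂ (proj₂ matching)))
  apart = proj₂ (proj₁ (proj₂ (proj₂ matching)))
  low = proj₂ (proj₂ (proj₂ matching))
  induced = mt M (All.map R⊆G edgesM , apart)
  M′ = proj₁ induced
  P? = _∈? M′
  k = length (filter P? M)
  s≤hk : s ≤ h * k
  s≤hk = begin
    s                   ≡⟨ |M|≡s ⟨
    length M            ≤⟨ proj₂ (proj₂ (proj₂ (proj₂ induced))) ⟩
    h * length M′       ≤⟨ *-monoʳ-≤ h (unique⇒length≤ unique′ (proj₁ (proj₂ (proj₂ induced)))) ⟩
    h * k               ∎
    where
    unique′ : Unique M′
    unique′ = AllPairs.map (λ (a≢ , _) → a≢ ∘ cong proj₁) (proj₂ (proj₁ (proj₂ induced)))
  instance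
    k≢0 : NonZero k
    k≢0 = ≢-nonZero (λ k≡0 → contradiction (≤-trans 1≤s (≤-trans s≤hk
      (≤-reflexive (trans (cong (h *_) k≡0) (*-zeroʳ h))))) (λ ()))
  high : 5 ^ k * y ^ length Y ≤ Val M (weight y Y)
  high = Val-lower P? M (λ _ → ⊥) (λ W _ → weight-lower y Y W) (λ _ _ ())
    (AllPairs.map separate apart)
    where
    -- An edge of `R` from the A-end of `e′` to the B-end of `e` is the second alternative of
    -- `Joined`.
    separate : ∀ {e e′} → NoSharedVertex R e e′ → e ∈ M′ → e′ ∈ M′ → Separated e e′
    separate (a≢ , _) e∈ e′∈ r = proj₁ (proj₂ (proj₂ (proj₂ induced))) e∈ e′∈
      (a≢ ∘ cong proj₁) (inj₂ (R⊆G r))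
  ratio₁ : suc (2 * h) ^ s ≤ 2 ^ k * (2 * h) ^ s
  ratio₁ = power-ratio (2 * h) h k s (≤-reflexive (cong (h +_) (sym (+-identityʳ h)))) s≤hk
  ratio₂ : suc y ^ length Y ≤ 2 ^ k * y ^ length Y
  ratio₂ = power-ratio y (16 * h) k (length Y)
    (≤-reflexive (solve 1 (λ h → con 16 :* h :+ con 16 :* h := con 32 :* h) refl h))
    (begin
      length Y       ≤⟨ ≤-trans |Y|≤m m≤16s ⟩
      16 * s         ≤⟨ *-monoʳ-≤ 16 s≤hk ⟩
      16 * (h * k)   ≡⟨ *-assoc 16 h k ⟨
      16 * h * k     ∎)
  5^k≤4^k : 5 ^ k ≤ 4 ^ k
  5^k≤4^k = *-cancelʳ-≤ (5 ^ k) (4 ^ k) U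
    {{m*n≢0 _ _ {{m^n≢0 N s {{>-nonZero 1≤N}}}} {{m^n≢0 y (length Y)}}}} (begin
    5 ^ k * U                                  ≡⟨ solve 3 (λ a b c → a :* (b :* c) := b :* (a :* c)) refl (5 ^ k) (N ^ s) (y ^ length Y) ⟩
    N ^ s * (5 ^ k * y ^ length Y)             ≤⟨ *-monoʳ-≤ (N ^ s) high ⟩
    N ^ s * Val M (weight y Y)                 ≤⟨ low ⟩
    (N + z) ^ s * suc y ^ length Y             ≡⟨ cong (λ x → x ^ s * suc y ^ length Y) (+-comm N z) ⟩
    (suc (2 * h) * z) ^ s * suc y ^ length Y   ≡⟨ cong (_* suc y ^ length Y) (^-distribʳ-* s (suc (2 * h)) z) ⟩
    suc (2 * h) ^ s * z ^ s * suc y ^ length Y ≤⟨ *-mono-≤ (*-monoˡ-≤ (z ^ s) ratio₁) ratio₂ ⟩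
    2 ^ k * (2 * h) ^ s * z ^ s * (2 ^ k * y ^ length Y)
      ≡⟨ solve 4 (λ t a z y → t :* a :* z :* (t :* y) := t :* t :* (a :* z :* y)) refl
           (2 ^ k) ((2 * h) ^ s) (z ^ s) (y ^ length Y) ⟩
    2 ^ k * 2 ^ k * ((2 * h) ^ s * z ^ s * y ^ length Y)
      ≡⟨ cong₂ (λ p q → p * (q * y ^ length Y)) (^-distribʳ-* k 2 2) (^-distribʳ-* s (2 * h) z) ⟨
    4 ^ k * U                                  ∎)
    where U = N ^ s * y ^ length Y
  4<5 : 4 < 5
  4<5 = ≤-refl

-- Maximal subgraphs of bounded degree

insert : ∀ {n} → BipartiteGraph n → Edge n → BipartiteGraph n
insert R (a₀ , b₀) a b = R a b ∨ (does (a Fin.≟ a₀) ∧ does (b Fin.≟ b₀))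

insert-⊇ : ∀ {n} (R : BipartiteGraph n) e a b → T (R a b) → T (insert R e a b)
insert-⊇ R e a b r with R a b
... | true = tt

insert-sound : ∀ {n} (R : BipartiteGraph n) a₀ b₀ a b → T (insert R (a₀ , b₀) a b) →
  T (R a b) ⊎ (a ≡ a₀ × b ≡ b₀)
insert-sound R a₀ b₀ a b r with R a b | a Fin.≟ a₀ | b Fin.≟ b₀
... | true  | _       | _       = inj₁ tt
... | false | yes a≡  | yes b≡  = inj₂ (a≡ , b≡)

insert-self : ∀ {n} (R : BipartiteGraph n) a b → T (insert R (a , b) a b)
insert-self R a b with R a b | a Fin.≟ a | b Fin.≟ b
... | true  | _      | _      = tt
... | false | yes _  | yes _  = tt
... | false | no a≢a | _      = ⊥-elim (a≢a refl)
... | false | yes _  | no b≢b = ⊥-elim (b≢b refl)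

⟦⟧-mono : ∀ r r′ → (T r → T r′) → ⟦ r ⟧ ≤ ⟦ r′ ⟧
⟦⟧-mono false r′    f = z≤n
⟦⟧-mono true  true  f = ≤-refl
⟦⟧-mono true  false f = ⊥-elim (f tt)

⟦⟧-cover : ∀ {P : Set} r g (P? : Dec P) → (T g → T r ⊎ P) → ⟦ g ⟧ ≤ ⟦ r ⟧ + ⟦ does P? ⟧ * ⟦ g ⟧
⟦⟧-cover r     false P?       f = z≤n
⟦⟧-cover true  true  P?       f = s≤s z≤n
⟦⟧-cover false true  (yes _)  f = ≤-refl
⟦⟧-cover false true  (no ¬p)  f with f tt
... | inj₂ p = contradiction p ¬p

insert-degree : ∀ {n} (R : BipartiteGraph n) a₀ b₀ {Y} → Unique Y → ∀ {c} →
  ∑ Y (λ b → ⟦ R a₀ b ⟧) < c → (∀ a → ∑ Y (λ b → ⟦ R a b ⟧) ≤ c) →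
  ∀ a → ∑ Y (λ b → ⟦ insert R (a₀ , b₀) a b ⟧) ≤ c
insert-degree R a₀ b₀ {Y} uY {c} d₀<c d≤c a with a Fin.≟ a₀
... | no  _    = ≤-trans (∑-mono Y same) (d≤c a)
  where
  same : ∀ b → ⟦ R a b ∨ false ⟧ ≤ ⟦ R a b ⟧
  same b with R a b
  ... | true  = ≤-refl
  ... | false = ≤-refl
... | yes refl = begin
  ∑ Y (λ b → ⟦ R a b ∨ does (b Fin.≟ b₀) ⟧)
    ≤⟨ ∑-mono Y plus ⟩
  ∑ Y (λ b → ⟦ does (b Fin.≟ b₀) ⟧ * 1 + ⟦ R a b ⟧)
    ≡⟨ ∑-+ Y _ _ ⟩
  ∑ Y (λ b → ⟦ does (b Fin.≟ b₀) ⟧ * 1) + ∑ Y (λ b → ⟦ R a b ⟧)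
    ≤⟨ +-monoˡ-≤ _ (∑-single uY (Fin._≟ b₀) (λ p q → trans p (sym q)) (λ _ → 1) (λ _ → ≤-refl)) ⟩
  suc (∑ Y (λ b → ⟦ R a b ⟧))
    ≤⟨ d₀<c ⟩
  c ∎
  where
  open ≤-Reasoning
  plus : ∀ b → ⟦ R a b ∨ does (b Fin.≟ b₀) ⟧ ≤ ⟦ does (b Fin.≟ b₀) ⟧ * 1 + ⟦ R a b ⟧
  plus b with R a b | b Fin.≟ b₀
  ... | true  | no  _ = ≤-refl
  ... | true  | yes _ = s≤s z≤n
  ... | false | no  _ = ≤-refl
  ... | false | yes _ = ≤-refl

module _ {n : ℕ} (G : BipartiteGraph n) {X Y : List (Fin n)} (uX : Unique X) (uY : Unique Y) (c : ℕ)
  where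

  -- Maximality appears as the consequence used later: an edge of `G` missing from `R` has a
  -- saturated end. Restricting it to the edges in `L` permits a construction edge by edge.
  record BoundedSubgraph (L : List (Edge n)) : Set where
    field
      R        : BipartiteGraph n
      R⊆G      : ∀ {a b} → T (R a b) → T (G a b)
      degreeA≤ : ∀ a → ∑ Y (λ b → ⟦ R a b ⟧) ≤ c
      degreeB≤ : ∀ b → ∑ X (λ a → ⟦ R a b ⟧) ≤ c
      maximal  : ∀ {a b} → (a , b) ∈ L → T (G a b) →
        T (R a b) ⊎ c ≤ ∑ Y (λ b → ⟦ R a b ⟧) ⊎ c ≤ ∑ X (λ a → ⟦ R a b ⟧)

  -- Each edge is added unless an end is already saturated. Degrees in `R` never decrease, so an
  -- earlier reason for rejection stays valid (`widen`).
  maximal-subgraph : ∀ L → BoundedSubgraph L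
  maximal-subgraph [] = record
    { R        = λ _ _ → false
    ; R⊆G      = λ ()
    ; degreeA≤ = λ _ → ≤-trans (≤-reflexive (∑-zero Y)) z≤n
    ; degreeB≤ = λ _ → ≤-trans (≤-reflexive (∑-zero X)) z≤n
    ; maximal  = λ ()
    }
  maximal-subgraph ((a₀ , b₀) ∷ L) with maximal-subgraph L
  ... | H with G a₀ b₀ in eq
                | c ≤? ∑ Y (λ b → ⟦ BoundedSubgraph.R H a₀ b ⟧)
                | c ≤? ∑ X (λ a → ⟦ BoundedSubgraph.R H a b₀ ⟧)
  ... | false | _     | _     = record
    { BoundedSubgraph H
    ; maximal = λ where
        (here refl) g → ⊥-elim (subst T eq g)
        (there e∈L) g → BoundedSubgraph.maximal H e∈L g
    }
  ... | true  | yes c≤ | _     = record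
    { BoundedSubgraph H
    ; maximal = λ where
        (here refl) g → inj₂ (inj₁ c≤)
        (there e∈L) g → BoundedSubgraph.maximal H e∈L g
    }
  ... | true  | no _  | yes c≤ = record
    { BoundedSubgraph H
    ; maximal = λ where
        (here refl) g → inj₂ (inj₂ c≤)
        (there e∈L) g → BoundedSubgraph.maximal H e∈L g
    }
  ... | true  | no A< | no B< = record
    { R        = R⁺
    ; R⊆G      = λ {a} {b} r → sound (insert-sound R a₀ b₀ a b r)
    ; degreeA≤ = insert-degree R a₀ b₀ uY (≰⇒> A<) degreeA≤
    -- The B-side is the A-side of `flip R`; flipping reverses the two tests inside `insert`, hence
    -- `∧-comm`.
    ; degreeB≤ = λ b → subst (_≤ c) (∑-cong X (λ a → cong (λ w → ⟦ R a b ∨ w ⟧)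
                           (∧-comm (does (b Fin.≟ b₀)) (does (a Fin.≟ a₀)))))
                         (insert-degree (flip R) b₀ a₀ uX (≰⇒> B<) degreeB≤ b)
    ; maximal  = λ where
        (here refl) _ → inj₁ (insert-self R a₀ b₀)
        {a} {b} (there e∈L) g → widen a b (maximal e∈L g)
    }
    where
    open BoundedSubgraph H
    R⁺ = insert R (a₀ , b₀)
    sound : ∀ {a b} → T (R a b) ⊎ (a ≡ a₀ × b ≡ b₀) → T (G a b)
    sound (inj₁ r)             = R⊆G r
    sound (inj₂ (refl , refl)) = subst T (sym eq) tt
    R≤R⁺ : ∀ a b → ⟦ R a b ⟧ ≤ ⟦ R⁺ a b ⟧
    R≤R⁺ a b = ⟦⟧-mono (R a b) (R⁺ a b) (insert-⊇ R (a₀ , b₀) a b)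
    widen : ∀ a b → T (R a b) ⊎ c ≤ ∑ Y (λ b → ⟦ R a b ⟧) ⊎ c ≤ ∑ X (λ a → ⟦ R a b ⟧) →
      T (R⁺ a b) ⊎ c ≤ ∑ Y (λ b → ⟦ R⁺ a b ⟧) ⊎ c ≤ ∑ X (λ a → ⟦ R⁺ a b ⟧)
    widen a b (inj₁ r)        = inj₁ (insert-⊇ R (a₀ , b₀) a b r)
    widen a b (inj₂ (inj₁ d)) = inj₂ (inj₁ (≤-trans d (∑-mono Y (R≤R⁺ a))))
    widen a b (inj₂ (inj₂ d)) = inj₂ (inj₂ (≤-trans d (∑-mono X (λ a → R≤R⁺ a b))))

-- The halving iteration

-- Induction on `l`: passing to the unsaturated part of X and the saturated part of Y lowers the
-- degree bound by `c` and more than halves `Y`. At `l = 0` the list `Y` is empty, yet the vertices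
-- of `X` have positive degree.
no-dense-pair : ∀ {n} (G : BipartiteGraph n) h .{{_ : NonZero h}} → Multitasks h G →
  ∀ {c} → κ * (h * h) ≡ c →
  ∀ l {X Y} → Unique X → Unique Y → length Y ≤ length X → 1 ≤ length X →
  (∀ {a} → a ∈ X → l * c < ∑ Y (λ b → ⟦ G a b ⟧)) → ¬ (length Y < 2 ^ l)
no-dense-pair G h mt c≡ zero {x ∷ X} {[]} uX uY Y≤X 1≤X deg _ with () ← deg (here refl)
no-dense-pair G h mt c≡ zero {Y = _ ∷ _} uX uY Y≤X 1≤X deg (s≤s ())
no-dense-pair {n} G h mt {c} c≡ (suc l) {x ∷ X} {[]} uX uY Y≤X 1≤X deg _ with () ← deg (here refl)
no-dense-pair {n} G h mt {c} c≡ (suc l) {X} {Y@(_ ∷ _)} uX uY Y≤X 1≤X deg Y<2^ =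
  no-dense-pair G h mt c≡ l (Unique.filter⁺ unsat? uX₁) (Unique.filter⁺ satB? uY)
    V≤U (≤-trans (s≤s z≤n) V<U) degree V<2^
  where
  open ≤-Reasoning
  m = length Y
  -- `X` is cut to the size of `Y`, so that the same `m` serves both sides in `near-regular-bound`.
  X₁ = take m X
  uX₁ = Unique.take⁺ m uX
  |X₁|≡m : length X₁ ≡ m
  |X₁|≡m = trans (length-take m X) (m≤n⇒m⊓n≡m Y≤X)
  open BoundedSubgraph (maximal-subgraph G uX₁ uY c (cartesianProduct X₁ Y))
  dA dB : Fin n → ℕ
  dA a = ∑ Y (λ b → ⟦ R a b ⟧)
  dB b = ∑ X₁ (λ a → ⟦ R a b ⟧)
  satA? : Decidable (λ a → c ≤ dA a)
  satA? a = c ≤? dA a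
  satB? : Decidable (λ b → c ≤ dB b)
  satB? b = c ≤? dB b
  unsat? : Decidable (λ a → dA a < c)
  unsat? a = dA a <? c
  S = filter satA? X₁
  U = filter unsat? X₁
  V = filter satB? Y
  sparse : 2 * edges R X₁ Y < c * m
  sparse = ≰⇒> (near-regular-bound G R h mt R⊆G uX₁ uY (≤-reflexive |X₁|≡m) ≤-refl (s≤s z≤n)
                  degreeA≤ degreeB≤ c≡)
  -- A set of `s` saturated vertices on one side carries at least `s * c` edges of `R`, so fewer
  -- than half of each side are saturated. Hence |V| < m/2 < |U|, which restores the size condition.
  half : ∀ s → s * c ≤ edges R X₁ Y → 2 * s < m
  half s sc≤e = *-cancelˡ-< c (2 * s) m (begin-strict
    c * (2 * s)         ≡⟨ solve 2 (λ c s → c :* (con 2 :* s) := con 2 :* (s :* c)) refl c s ⟩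
    2 * (s * c)         ≤⟨ *-monoʳ-≤ 2 sc≤e ⟩
    2 * edges R X₁ Y    <⟨ sparse ⟩
    c * m               ∎)
  2S<m : 2 * length S < m
  2S<m = half (length S) (length-filter*≤∑ satA? X₁ dA id)
  2V<m : 2 * length V < m
  2V<m = half (length V) (≤-trans (length-filter*≤∑ satB? Y dB id)
                                  (≤-reflexive (sym (∑-swap X₁ Y (λ a b → ⟦ R a b ⟧)))))
  m≤U+S : m ≤ length U + length S
  m≤U+S = subst (_≤ length U + length S) |X₁|≡m
    (length-filter-cover unsat? satA? (λ a → <-≤-connex (dA a) c) X₁)
  V<U : length V < length U
  V<U = *-cancelˡ-< 2 _ _ (+-cancelʳ-< m _ _ (begin-strict
    2 * length V + m                  <⟨ +-monoˡ-< m 2V<m ⟩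
    m + m                             ≤⟨ +-mono-≤ m≤U+S m≤U+S ⟩
    length U + length S + (length U + length S)
      ≡⟨ solve 2 (λ u s → u :+ s :+ (u :+ s) := con 2 :* u :+ con 2 :* s) refl (length U) (length S) ⟩
    2 * length U + 2 * length S       ≤⟨ +-monoʳ-≤ (2 * length U) (<⇒≤ 2S<m) ⟩
    2 * length U + m                  ∎))
  V≤U : length V ≤ length U
  V≤U = <⇒≤ V<U
  V<2^ : length V < 2 ^ l
  V<2^ = *-cancelˡ-< 2 _ _ (<-trans 2V<m Y<2^)
  degree : ∀ {a} → a ∈ U → l * c < ∑ V (λ b → ⟦ G a b ⟧)
  degree {a} a∈U with ∈-filter⁻ unsat? {xs = X₁} a∈U
  -- Since `a` is unsaturated, maximality puts every edge of `G` from `a` into `R` or sends it to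
  -- `V`; fewer than `c` are in `R`.
  ... | a∈X₁ , dA<c = +-cancelˡ-< c _ _ (begin-strict
    c + l * c                                <⟨ deg (∈-take m X a∈X₁) ⟩
    ∑ Y (λ b → ⟦ G a b ⟧)                    ≤⟨ ∑-mono-∈ Y split ⟩
    ∑ Y (λ b → ⟦ R a b ⟧ + ⟦ does (satB? b) ⟧ * ⟦ G a b ⟧)
      ≡⟨ ∑-+ Y (λ b → ⟦ R a b ⟧) _ ⟩
    dA a + ∑ Y (λ b → ⟦ does (satB? b) ⟧ * ⟦ G a b ⟧)
      ≡⟨ cong (dA a +_) (∑-filter satB? Y _) ⟨
    dA a + ∑ V (λ b → ⟦ G a b ⟧)             ≤⟨ +-monoˡ-≤ _ (<⇒≤ dA<c) ⟩
    c + ∑ V (λ b → ⟦ G a b ⟧)                ∎)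
    where
    ∈-take : ∀ {A : Set} k (xs : List A) {x} → x ∈ take k xs → x ∈ xs
    ∈-take (suc k) (x ∷ xs) (here eq)  = here eq
    ∈-take (suc k) (x ∷ xs) (there x∈) = there (∈-take k xs x∈)
    split : ∀ {b} → b ∈ Y → ⟦ G a b ⟧ ≤ ⟦ R a b ⟧ + ⟦ does (satB? b) ⟧ * ⟦ G a b ⟧
    split {b} b∈Y = ⟦⟧-cover (R a b) (G a b) (satB? b) λ g →
      case maximal (∈-cartesianProduct⁺ a∈X₁ b∈Y) g of λ where
        (inj₁ r)          → inj₁ r
        (inj₂ (inj₁ sat)) → contradiction sat (<⇒≱ dA<c)
        (inj₂ (inj₂ sat)) → inj₂ sat

-- Subgraphs of large minimum degree

module _ {n : ℕ} (G : BipartiteGraph n) (D : ℕ) where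

  record DenseCore : Set where
    field
      X Y     : List (Fin n)
      uX      : Unique X
      uY      : Unique Y
      |X|≤n   : length X ≤ n
      |Y|≤n   : length Y ≤ n
      1≤|X|   : 1 ≤ length X
      highA   : ∀ {a} → a ∈ X → D < ∑ Y (λ b → ⟦ G a b ⟧)
      highB   : ∀ {b} → b ∈ Y → D < ∑ X (λ a → ⟦ G a b ⟧)

  private
    -- Deleting x - x′ vertices at a cost of at most `D` edges each keeps more than `D` edges per
    -- vertex; all differences are moved to the other side.
    trim : ∀ {s t} x x′ {e e′} → s + x′ ≡ t + x → s * D < e → e + x′ * D ≤ e′ + x * D → t * D < e′
    trim {s} {t} x x′ {e} {e′} eq lt le = +-cancelʳ-< (x * D) _ _ (begin-strict
      t * D + x * D   ≡⟨ *-distribʳ-+ D t x ⟨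
      (t + x) * D     ≡⟨ cong (_* D) eq ⟨
      (s + x′) * D    ≡⟨ *-distribʳ-+ D s x′ ⟩
      s * D + x′ * D  <⟨ +-monoˡ-< (x′ * D) lt ⟩
      e + x′ * D      ≤⟨ le ⟩
      e′ + x * D      ∎)
      where open ≤-Reasoning

  -- Vertices of degree at most `D` are deleted, all those of one side at once, until none is left.
  -- By `trim` the density survives, so edges remain and the core is not empty. `fuel` exceeds the
  -- number of vertices, which drops each time.
  dense-core : ∀ fuel {X Y} → Unique X → Unique Y → length X ≤ n → length Y ≤ n →
    length X + length Y < fuel → (length X + length Y) * D < edges G X Y → DenseCore
  dense-core (suc fuel) {X} {Y} uX uY |X|≤n |Y|≤n (s≤s bound) dense
    with All.all? highA? X | All.all? highB? Y
    where
    highA? : Decidable (λ a → D < ∑ Y (λ b → ⟦ G a b ⟧))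
    highA? a = D <? _
    highB? : Decidable (λ b → D < ∑ X (λ a → ⟦ G a b ⟧))
    highB? b = D <? _
  ... | yes allA | yes allB = record
    { uX = uX ; uY = uY ; |X|≤n = |X|≤n ; |Y|≤n = |Y|≤n ; 1≤|X| = nonempty X dense
    ; highA = All.lookup allA ; highB = All.lookup allB }
    where
    nonempty : ∀ X → (length X + length Y) * D < edges G X Y → 1 ≤ length X
    nonempty (_ ∷ _) _ = s≤s z≤n
  ... | no ¬allA | _ = dense-core fuel (Unique.filter⁺ highA? uX) uY
    (≤-trans (length-filter highA? X) |X|≤n) |Y|≤n
    (≤-trans (+-monoˡ-< (length Y) (filter-notAll highA? X (All.¬All⇒Any¬ highA? X ¬allA))) bound)
    (trim (length X) (length (filter highA? X))
      (solve 3 (λ x y x′ → x :+ y :+ x′ := x′ :+ y :+ x) refl (length X) (length Y) _) dense (∑-filter-bound highA? X _ ≮⇒≥))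
    where
    highA? : Decidable (λ a → D < ∑ Y (λ b → ⟦ G a b ⟧))
    highA? a = D <? _
  ... | yes _ | no ¬allB = dense-core fuel uX (Unique.filter⁺ highB? uY)
    |X|≤n (≤-trans (length-filter highB? Y) |Y|≤n)
    (≤-trans (+-monoʳ-< (length X) (filter-notAll highB? Y (All.¬All⇒Any¬ highB? Y ¬allB))) bound)
    (subst ((length X + length (filter highB? Y)) * D <_) (sym (∑-swap X (filter highB? Y) (λ a b → ⟦ G a b ⟧)))
      (trim (length Y) (length (filter highB? Y))
        (solve 3 (λ x y y′ → x :+ y :+ y′ := x :+ y′ :+ y) refl (length X) (length Y) _)
        (subst ((length X + length Y) * D <_) (∑-swap X Y (λ a b → ⟦ G a b ⟧)) dense)
        (∑-filter-bound highB? Y _ ≮⇒≥)))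
    where
    highB? : Decidable (λ b → D < ∑ X (λ a → ⟦ G a b ⟧))
    highB? b = D <? _

-- The edge bound for multitaskers

Multitasks-flip : ∀ {n} h {G : BipartiteGraph n} → Multitasks h G → Multitasks h (flip G)
Multitasks-flip h {G} mt M (edge , apart)
  with mt (map swap M) (All.map⁺ edge , AllPairs.map⁺ (AllPairs.map swap apart))
... | M′ , (edge′ , apart′) , M′⊆ , ind , long =
  map swap M′ , (All.map⁺ edge′ , AllPairs.map⁺ (AllPairs.map swap apart′)) , sub , ind′ ,
  subst₂ (λ p q → p ≤ h * q) (length-map swap M) (sym (length-map swap M′)) long
  where
  sub : map swap M′ ⊆ M
  sub x∈ with ∈-map⁻ swap x∈
  ... | y , y∈ , refl with ∈-map⁻ swap (M′⊆ y∈)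
  ... | z , z∈ , refl = z∈
  ind′ : IsInduced (flip G) (map swap M′)
  ind′ e∈ e′∈ e≢e′ joined with ∈-map⁻ swap e∈ | ∈-map⁻ swap e′∈
  ... | u , u∈ , refl | v , v∈ , refl =
    ind u∈ v∈ (e≢e′ ∘ cong swap) (Sum.swap joined)

-- With more edges there would be a dense core of minimum degree above `l * c`, c = κh²,
-- contradicting `no-dense-pair`.
multitasker-edges : ∀ {n} (G : BipartiteGraph n) h .{{_ : NonZero h}} → Multitasks h G →
  ∀ l → n < 2 ^ l → edges G (allFin n) (allFin n) ≤ (n + n) * (l * (κ * (h * h)))
multitasker-edges {n} G h mt l n<2^l with edges G (allFin n) (allFin n) ≤? (n + n) * (l * (κ * (h * h)))
... | yes few = few
... | no many = ⊥-elim (sparser (≤-total (length Y) (length X)))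
  where
  |allFin| : length (allFin n) ≡ n
  |allFin| = length-tabulate id
  open DenseCore (dense-core G (l * (κ * (h * h))) _ (Unique.allFin⁺ n) (Unique.allFin⁺ n)
    (≤-reflexive |allFin|) (≤-reflexive |allFin|) ≤-refl
    (subst (λ k → (k + k) * (l * (κ * (h * h))) < edges G (allFin n) (allFin n)) (sym |allFin|) (≰⇒> many)))
  sparser : length Y ≤ length X ⊎ length X ≤ length Y → ⊥
  sparser (inj₁ Y≤X) = no-dense-pair G h mt refl l uX uY Y≤X 1≤|X| highA (≤-<-trans |Y|≤n n<2^l)
  -- The larger side has to play the role of X, so here the graph is flipped.
  sparser (inj₂ X≤Y) = no-dense-pair (flip G) h (Multitasks-flip h {G} mt) refl l uY uX X≤Y
    (≤-trans 1≤|X| X≤Y) highB (≤-<-trans |X|≤n n<2^l)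

-- From natural numbers to the real inequality

-- The number of binary digits: the first bound provides enough halvings, the second compares `l`
-- with the logarithm of n.
binary-length : ∀ n .{{_ : NonZero n}} → ∃ λ l → n < 2 ^ l × 2 ^ l ≤ 2 * n
binary-length (suc zero)    = 1 , ≤-refl , ≤-refl
binary-length (suc n@(suc _)) with binary-length n
... | l , n<2^l , 2^l≤2n with suc n <? 2 ^ l
...   | yes lt = l , lt , ≤-trans 2^l≤2n (*-monoʳ-≤ 2 (n≤1+n n))
...   | no  ge = suc l ,
    <-≤-trans (m<m*n (suc n) 2 ≤-refl) (≤-trans (≤-reflexive (*-comm (suc n) 2)) (*-monoʳ-≤ 2 n<2^l)) ,
    *-monoʳ-≤ 2 (≮⇒≥ ge)

/-*-homo : ∀ a b c → (ℤ.+ a ℚ./ suc b) ℚ.* (ℤ.+ c ℚ./ 1) ≡ ℤ.+ (a * c) ℚ./ suc b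
/-*-homo a b c = ℚ.toℚᵘ-injective (begin
  ℚ.toℚᵘ ((ℤ.+ a ℚ./ suc b) ℚ.* (ℤ.+ c ℚ./ 1))
    ≈⟨ ℚ.toℚᵘ-homo-* (ℤ.+ a ℚ./ suc b) (ℤ.+ c ℚ./ 1) ⟩
  ℚ.toℚᵘ (ℤ.+ a ℚ./ suc b) ℚᵘ.* ℚ.toℚᵘ (ℤ.+ c ℚ./ 1)
    ≈⟨ ℚᵘ.*-cong (ℚ.toℚᵘ-fromℚᵘ (ℚᵘ.mkℚᵘ (ℤ.+ a) b)) (ℚ.toℚᵘ-fromℚᵘ (ℚᵘ.mkℚᵘ (ℤ.+ c) 0)) ⟩
  ℚᵘ.mkℚᵘ (ℤ.+ a) b ℚᵘ.* ℚᵘ.mkℚᵘ (ℤ.+ c) 0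
    ≈⟨ ℚᵘ.*≡* (cong₂ ℤ._*_ (sym (ℤ.pos-* a c)) (cong (ℤ.+_ ∘ suc) (sym (*-identityʳ b)))) ⟩
  ℚᵘ.mkℚᵘ (ℤ.+ (a * c)) b
    ≈⟨ ℚ.toℚᵘ-fromℚᵘ (ℚᵘ.mkℚᵘ (ℤ.+ (a * c)) b) ⟨
  ℚ.toℚᵘ (ℤ.+ (a * c) ℚ./ suc b) ∎)
  where open ℚᵘ.≃-Reasoning

ι : ℕ → ℚ
ι k = ℤ.+ k ℚ./ 1

ι-* : ∀ a c → ι (a * c) ≡ ι a ℚ.* ι c
ι-* a c = sym (/-*-homo a 0 c)

ι-mono-≤ : ∀ a c → a ≤ c → ι a ℚ.≤ ι c
ι-mono-≤ a c a≤c = /-mono-≤ a 0 c 0 (*-monoˡ-≤ 1 a≤c)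

ι-mono-< : ∀ a c → a < c → ι a ℚ.< ι c
ι-mono-< a c a<c = /-mono-< a 0 c 0 (*-monoˡ-< 1 a<c)

-- h = ⌊1/q⌋ + 1, so that qh lies between 1 and 1 + q.
reciprocal : ∀ q → 0ℚ ℚ.< q → q ℚ.< 1ℚ →
  ∃ λ h → NonZero h × ι 1 ℚ.≤ q ℚ.* ι h × q ℚ.* ι h ℚ.≤ ι 2
reciprocal (ℚ.mkℚ (ℤ.+ zero)  b _) 0<q q<1 = contradiction (ℚ.positive 0<q) λ ()
reciprocal (ℚ.mkℚ ℤ.-[1+ _ ] b _) 0<q q<1 = contradiction (ℚ.positive 0<q) λ ()
reciprocal q@(ℚ.mkℚ (ℤ.+ suc a) b _) 0<q q<1 =
  suc k , _ , subst (ι 1 ℚ.≤_) (sym qh≡) (/-mono-≤ 1 0 (suc a * suc k) b lower) ,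
  subst (ℚ._≤ ι 2) (sym qh≡) (/-mono-≤ (suc a * suc k) b 2 0 upper)
  where
  open ≤-Reasoning
  k = suc b / suc a
  qh≡ : q ℚ.* ι (suc k) ≡ ℤ.+ (suc a * suc k) ℚ./ suc b
  qh≡ = trans (cong (ℚ._* ι (suc k)) (sym (ℚ.↥p/↧p≡p q))) (/-*-homo (suc a) b (suc k))
  a≤b : suc a ≤ suc b
  a≤b = <⇒≤ (ℤ.drop‿+<+ (subst₂ ℤ._<_ (ℤ.*-identityʳ (ℤ.+ suc a)) (ℤ.*-identityˡ (ℤ.+ suc b)) (ℚ.drop-*<* q<1)))
  lower : 1 * suc b ≤ suc a * suc k * 1
  lower = begin
    1 * suc b                         ≡⟨ *-identityˡ (suc b) ⟩
    suc b                             ≡⟨ m≡m%n+[m/n]*n (suc b) (suc a) ⟩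
    suc b % suc a + k * suc a         ≤⟨ +-monoˡ-≤ (k * suc a) (<⇒≤ (m%n<n (suc b) (suc a))) ⟩
    suc a + k * suc a                 ≡⟨ solve 2 (λ a k → a :+ k :* a := a :* (con 1 :+ k) :* con 1) refl (suc a) k ⟩
    suc a * suc k * 1                 ∎
  upper : suc a * suc k * 1 ≤ 2 * suc b
  upper = begin
    suc a * suc k * 1                 ≡⟨ solve 2 (λ a k → a :+ k :* a := a :* (con 1 :+ k) :* con 1) refl (suc a) k ⟨
    suc a + k * suc a                 ≤⟨ +-mono-≤ a≤b (m/n*n≤m (suc b) (suc a)) ⟩
    suc b + suc b                     ≡⟨ cong (suc b +_) (+-identityʳ (suc b)) ⟨
    2 * suc b                         ∎

-- If h|M′| < |M|, then |M′| ≤ q · h|M′| puts the rational |M′| into the open cut of α|M|, hence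
-- strictly below itself.
multitasker⇒Multitasks : ∀ {n} {α} {G : BipartiteGraph n} {q} h → Below α q → ι 1 ℚ.≤ q ℚ.* ι h →
  IsMultitasker α G → Multitasks h G
multitasker⇒Multitasks {α = α} {q = q} h αq 1≤qh mt M matching with mt M matching
... | M′ , matching′ , M′⊆M , induced , α|M|≤|M′| =
  M′ , matching′ , M′⊆M , induced , ≮⇒≥ (long (length M′) (length M) α|M|≤|M′|)
  where
  0<q : 0ℚ ℚ.< q
  0<q = isPositive α αq
  long : ∀ k s → α *ᴿ fromℕ s ≤ᴿ fromℕ k → ¬ (h * k < s)
  -- The real 0 is the empty cut, while q/2 lies in that of α|M| because 1/2 < 1 ≤ |M|.
  long zero s le hk<s = ℚ.<-asym (proj₁ absurd) (proj₂ absurd)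
    where
    ½ = ℚ.½
    absurd : 0ℚ ℚ.< q ℚ.* ½ × q ℚ.* ½ ℚ.< 0ℚ
    absurd = le (*-pos 0<q (ℚ.positive⁻¹ ½) , q , ½ , αq ,
      (ℚ.positive⁻¹ ½ , ℚ.<-≤-trans (/-mono-< 1 1 1 0 ≤-refl)
        (ι-mono-≤ 1 s (≤-trans (s≤s z≤n) hk<s))) , ℚ.≤-refl)
  long (suc k) s le hk<s = ℚ.<-irrefl refl (proj₂ (le
    ( 0<k , q , ι (h * suc k) , αq
    , (subst (0ℚ ℚ.<_) (sym (ι-* h (suc k))) (*-pos 0<h 0<k) , ι-mono-< (h * suc k) s hk<s) , k≤qhk)))
    where
    0<k : 0ℚ ℚ.< ι (suc k)
    0<k = ι-mono-< 0 (suc k) (s≤s z≤n)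
    0<h : 0ℚ ℚ.< ι h
    0<h = nz h 1≤qh
      where
      nz : ∀ h → ι 1 ℚ.≤ q ℚ.* ι h → 0ℚ ℚ.< ι h
      nz zero    1≤0 = ⊥-elim (ℚ.<-irrefl refl (ℚ.<-≤-trans (ι-mono-< 0 1 (s≤s z≤n))
        (ℚ.≤-trans 1≤0 (ℚ.≤-reflexive (ℚ.*-zeroʳ q)))))
      nz (suc h) _  = ι-mono-< 0 (suc h) (s≤s z≤n)
    k≤qhk : ι (suc k) ℚ.≤ q ℚ.* ι (h * suc k)
    k≤qhk = subst₂ ℚ._≤_ (ℚ.*-identityˡ (ι (suc k)))
      (trans (ℚ.*-assoc q (ι h) (ι (suc k))) (cong (q ℚ.*_) (sym (ι-* h (suc k)))))
      (ℚ.*-monoʳ-≤-nonNeg (ι (suc k)) {{ℚ.nonNegative (ℚ.<⇒≤ 0<k)}} 1≤qh)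

-- Both degree sums equal the number of edges, so the average over the 2n vertices is that number
-- divided by n.
multitasker-degree : ∀ {n} .{{_ : NonZero n}} (G : BipartiteGraph n) h .{{_ : NonZero h}} → Multitasks h G →
  ∀ l → n < 2 ^ l → averageDegree G ℚ.≤ ι (2 * (l * (κ * (h * h))))
multitasker-degree {n@(suc n-1)} G h mt l n<2^l =
  /-mono-≤ (sum (map (degreeA G) V) + sum (map (degreeB G) V)) (pred (2 * n)) (2 * c) 0 (begin
  (sum (map (degreeA G) V) + sum (map (degreeB G) V)) * 1
    ≡⟨ *-identityʳ _ ⟩
  sum (map (degreeA G) V) + sum (map (degreeB G) V)
    ≡⟨ cong₂ _+_
         (trans (sum-map≡∑ V (degreeA G)) (∑-cong V (λ a → length-filterᵇ V (G a))))
         (trans (sum-map≡∑ V (degreeB G))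
           (trans (∑-cong V (λ b → length-filterᵇ V (λ a → G a b))) (∑-swap V V (λ b a → ⟦ G a b ⟧)))) ⟩
  edges G V V + edges G V V
    ≤⟨ +-mono-≤ few few ⟩
  (n + n) * c + (n + n) * c
    ≡⟨ solve 2 (λ n c → (n :+ n) :* c :+ (n :+ n) :* c := con 2 :* c :* (con 2 :* n)) refl n c ⟩
  2 * c * (2 * n) ∎)
  where
  open ≤-Reasoning
  V = allFin n
  c = l * (κ * (h * h))
  few : edges G V V ≤ (n + n) * c
  few = multitasker-edges G h mt l n<2^l

1/64 : ℚ
1/64 = ℤ.+ 1 ℚ./ 64

-- Two factors `q` combine with `h * h` into (qh)² ≤ 4, and the third is at most 1.
cube-bound-by-log : ∀ {q d} h l → 0ℚ ℚ.< q → q ℚ.< 1ℚ → ι 1 ℚ.≤ q ℚ.* ι h → q ℚ.* ι h ℚ.≤ ι 2 →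
  d ℚ.≤ ι (2 * (l * (κ * (h * h)))) → cube (q ℚ.* 1/64) ℚ.* d ℚ.≤ ℤ.+ l ℚ./ 4
cube-bound-by-log {q} {d} h l 0<q q<1 1≤qh qh≤2 d≤ = begin
  cube (q ℚ.* 1/64) ℚ.* d
    ≤⟨ ℚ.*-monoˡ-≤-nonNeg (cube (q ℚ.* 1/64)) {{ℚ.nonNegative (ℚ.<⇒≤ (cube-pos (*-pos 0<q (ℚ.positive⁻¹ 1/64))))}} d≤ ⟩
  cube (q ℚ.* 1/64) ℚ.* ι (2 * (l * (κ * (h * h))))
    ≡⟨ cong (cube (q ℚ.* 1/64) ℚ.*_) ι-product ⟩
  cube (q ℚ.* 1/64) ℚ.* (ι 2 ℚ.* (L ℚ.* (ι 2560 ℚ.* (H ℚ.* H))))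
    ≡⟨ rearrange q 1/64 (ι 2) L (ι 2560) H ⟩
  1/64 ℚ.* 1/64 ℚ.* 1/64 ℚ.* ι 2 ℚ.* ι 2560 ℚ.* (q ℚ.* H ℚ.* (q ℚ.* H) ℚ.* q) ℚ.* L
    ≤⟨ ℚ.*-monoʳ-≤-nonNeg L {{ℚ.nonNegative (ι-mono-≤ 0 l z≤n)}}
         (ℚ.*-monoˡ-≤-nonNeg (1/64 ℚ.* 1/64 ℚ.* 1/64 ℚ.* ι 2 ℚ.* ι 2560)
           (*-mono-≤⁺ (*-pos 0<qh 0<qh) (ℚ.positive⁻¹ 1ℚ)
             (*-mono-≤⁺ 0<qh (ℚ.positive⁻¹ (ι 2)) qh≤2 qh≤2) (ℚ.<⇒≤ q<1))) ⟩
  1/64 ℚ.* 1/64 ℚ.* 1/64 ℚ.* ι 2 ℚ.* ι 2560 ℚ.* (ι 2 ℚ.* ι 2 ℚ.* 1ℚ) ℚ.* L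
    ≤⟨ ℚ.*-monoʳ-≤-nonNeg L {{ℚ.nonNegative (ι-mono-≤ 0 l z≤n)}}
         -- The constant is 2 * 2560 * 4 / 64³ = 5/64.
         (toWitness {a? = 1/64 ℚ.* 1/64 ℚ.* 1/64 ℚ.* ι 2 ℚ.* ι 2560 ℚ.* (ι 2 ℚ.* ι 2 ℚ.* 1ℚ) ℚ.≤? ℤ.+ 1 ℚ./ 4} tt) ⟩
  (ℤ.+ 1 ℚ./ 4) ℚ.* L
    ≡⟨ trans (/-*-homo 1 3 l) (cong (λ l → ℤ.+ l ℚ./ 4) (*-identityˡ l)) ⟩
  ℤ.+ l ℚ./ 4 ∎
  where
  open ℚ.≤-Reasoning
  L = ι l
  H = ι h
  0<qh : 0ℚ ℚ.< q ℚ.* H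
  0<qh = ℚ.<-≤-trans (ℚ.positive⁻¹ 1ℚ) 1≤qh
  ι-product : ι (2 * (l * (κ * (h * h)))) ≡ ι 2 ℚ.* (L ℚ.* (ι 2560 ℚ.* (H ℚ.* H)))
  ι-product = trans (ι-* 2 (l * (κ * (h * h)))) (cong (ι 2 ℚ.*_)
    (trans (ι-* l (κ * (h * h))) (cong (L ℚ.*_)
      (trans (ι-* κ (h * h)) (cong₂ ℚ._*_ (cong ι κ≡) (ι-* h h))))))
  rearrange : ∀ q w t L k H → cube (q ℚ.* w) ℚ.* (t ℚ.* (L ℚ.* (k ℚ.* (H ℚ.* H)))) ≡
    w ℚ.* w ℚ.* w ℚ.* t ℚ.* k ℚ.* (q ℚ.* H ℚ.* (q ℚ.* H) ℚ.* q) ℚ.* L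
  rearrange = Q.solve 6 (λ q w t L k H →
      (q Q.:* w) Q.:* (q Q.:* w) Q.:* (q Q.:* w) Q.:* (t Q.:* (L Q.:* (k Q.:* (H Q.:* H)))) Q.:=
      w Q.:* w Q.:* w Q.:* t Q.:* k Q.:* (q Q.:* H Q.:* (q Q.:* H) Q.:* q) Q.:* L) refl
    where module Q = ℚ-Solver

multitasker-bound : ∀ n .{{_ : NonZero n}} → 2 ≤ n → (G : BipartiteGraph n) .{{_ : Positive (averageDegree G)}} →
  (α : ℝ≥0) → α ≤ᴿ fromℕ 1 → IsMultitasker α G → ∀ {q} → Below α q →
  Below (fromℕ 128 *ᴿ ∛ (log₂ n ÷ᴿ averageDegree G)) q
multitasker-bound n 2≤n G α α≤1 mt {q} αq =
  -- `q` is split as 64 · (q/64): 64 lies strictly below the constant 128, and q/64 below the cube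
  -- root.
  0<q , ι 64 , q ℚ.* 1/64 ,
  (ι-mono-< 0 64 (s≤s z≤n) , ι-mono-< 64 128 (≤ᵇ⇒≤ 65 128 tt)) ,
  -- The fraction l/4 lies below the logarithm, with `3` encoding the denominator 4: 2^l ≤ 2n ≤ n² <
  -- n⁴ as n ≥ 2.
  (0<qw , (*-pos (cube-pos 0<qw) 0<d , l , 3 , small , 2^l<n^4)) ,
  ℚ.≤-reflexive q≡
  where
  0<q = isPositive α αq
  q<1 = proj₂ (α≤1 αq)
  0<qw = *-pos 0<q (ℚ.positive⁻¹ 1/64)
  0<d : 0ℚ ℚ.< averageDegree G
  0<d = ℚ.positive⁻¹ (averageDegree G)
  recip = reciprocal q 0<q q<1
  h = proj₁ recip
  instance
    _ : NonZero h
    _ = proj₁ (proj₂ recip)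
  1≤qh = proj₁ (proj₂ (proj₂ recip))
  qh≤2 = proj₂ (proj₂ (proj₂ recip))
  len = binary-length n
  l = proj₁ len
  small : cube (q ℚ.* 1/64) ℚ.* averageDegree G ℚ.≤ ℤ.+ l ℚ./ 4
  small = cube-bound-by-log h l 0<q q<1 1≤qh qh≤2
    (multitasker-degree G h (multitasker⇒Multitasks {α = α} h αq 1≤qh mt) l (proj₁ (proj₂ len)))
  2^l<n^4 : 2 ^ l < n ^ 4
  2^l<n^4 = begin-strict
    2 ^ l      ≤⟨ proj₂ (proj₂ len) ⟩
    2 * n      ≤⟨ *-monoˡ-≤ n 2≤n ⟩
    n * n      ≡⟨ cong (n *_) (*-identityʳ n) ⟨
    n ^ 2      <⟨ ^-monoʳ-< n 2≤n {2} {4} (s≤s (s≤s (s≤s z≤n))) ⟩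
    n ^ 4      ∎
    where open ≤-Reasoning
  q≡ : q ≡ ι 64 ℚ.* (q ℚ.* 1/64)
  q≡ = begin
    q                         ≡⟨ ℚ.*-identityʳ q ⟨
    q ℚ.* (1/64 ℚ.* ι 64)     ≡⟨ ℚ.*-assoc q 1/64 (ι 64) ⟨
    q ℚ.* 1/64 ℚ.* ι 64       ≡⟨ ℚ.*-comm (q ℚ.* 1/64) (ι 64) ⟩
    ι 64 ℚ.* (q ℚ.* 1/64)     ∎
    where open ≡-Reasoning

theorem1p3 : ∃ λ (C : ℝ≥0) → 0<ᴿ C ×
    (∀ (n : ℕ) .{{_ : NonZero n}} → 2 ≤ n →
    (G : BipartiteGraph n) .{{_ : Positive (averageDegree G)}} →
    (α : ℝ≥0) → 0<ᴿ α → α ≤ᴿ fromℕ 1 →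
    IsMultitasker α G →
    α ≤ᴿ C *ᴿ ∛ (log₂ n ÷ᴿ averageDegree G))
theorem1p3 = fromℕ 128 , (1ℚ , ℚ.positive⁻¹ 1ℚ , ι-mono-< 1 128 (s≤s (s≤s z≤n))) ,
  λ n 2≤n G α _ α≤1 mt → multitasker-bound n 2≤n G α α≤1 mt
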